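{- The following decision problem is in $\mathrm{PTIME}$: given a generalized reachability game $\mathcal{G} = (\mathcal{A}, \mathrm{GenReach}(F_1,\ldots,F_k))$ in which every reachability set $F_i$ ($1\le i\le k$) is a singleton, and a starting vertex $v_0$, decide whether Eve wins from $v_0$.
   Context: An arena $\mathcal{A} = (V,(V_\circ,V_\Box),E)$ consists of a finite directed graph $(V,E)$, in which every vertex has at least one outgoing edge, and a partition $(V_\circ,V_\Box)$ of $V$: vertices in $V_\circ$ are controlled by Eve, vertices in $V_\Box$ by Adam. A play is an infinite path $\pi = v_0,v_1,v_2,\ldots$ in the graph. From a starting vertex $v_0$, at each step the player controlling the current vertex chooses an outgoing edge, and the play moves along it. A strategy for Eve is a function $\sigma : V^*\cdot V_\circ \to V$ with $(v,\sigma(w\cdot v))\in E$ for all $w \in V^*$, $v \in V_\circ$; strategies $\tau$ for Adam are defined similarly with $V_\Box$. A starting vertex $v_0$ and strategies $\sigma,\tau$ determine a unique play $\pi(v_0,\sigma,\tau)$. A game is a pair $(\mathcal{A},\Phi)$ with $\Phi$ a set of plays; Eve wins a play iff it belongs to $\Phi$, and Adam wins it otherwise. Eve wins from $v_0$ if she has a strategy $\sigma$ such that for every strategy $\tau$ of Adam, $\pi(v_0,\sigma,\tau)\in\Phi$. Given subsets $F_1,\ldots,F_k \subseteq V$ (reachability sets), the generalized reachability objective is $$\mathrm{GenReach}(F_1,\ldots,F_k) = \{ v_0,v_1,v_2,\ldots \mid \forall i\in\{1,\ldots,k\},\ \exists p_i\in\mathbb{N},\ v_{p_i}\in F_i\}.$$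 A generalized reachability game is a game of the form $(\mathcal{A},\mathrm{GenReach}(F_1,\ldots,F_k))$. The input is the explicitly given finite graph, partition, sets $F_1,\ldots,F_k$ and starting vertex; $k$ is part of the input. -}

module Defs where

open import Level using (0ℓ)
open import Data.Bool using (Bool; true; false)
open import Data.Fin using (Fin)
open import Data.Fin.Subset using (Subset; _∈_; ∁; ⁅_⁆; Nonempty)
open import Data.Fin.Subset.Properties using (_∈?_; x∉p⇒x∈∁p)
open import Data.List using (List; []; _∷_; _++_; _∷ʳ_; length; concatMap; map; replicate)
open import Data.Maybe using (Maybe; just; nothing)
open import Data.Nat using (ℕ; zero; suc; _+_; _*_; _^_)
open import Data.Product using (Σ-syntax; ∃; ∃-syntax; _×_; _,_; proj₁; proj₂)
open import Data.Vec as Vec using (Vec; lookup; toList)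
open import Function.Bundles using (_↔_; _⇔_)
open import Relation.Binary.PropositionalEquality using (_≡_)
open import Relation.Nullary using (yes; no)
open import Relation.Unary using (Pred)

record Arena : Set where
  field
    ∣V∣         : ℕ
    V∘          : Subset ∣V∣
    -- Row v is the set of successors of v.
    successors  : Vec (Subset ∣V∣) ∣V∣
    no-dead-end : ∀ v → Nonempty (lookup successors v)

  V : Set
  V = Fin ∣V∣

  V□ : Subset ∣V∣
  V□ = ∁ V∘

  E : V → V → Set
  E v u = u ∈ lookup successors v

module _ (𝒜 : Arena) where
  open Arena 𝒜

  -- Vertex sequences with consecutive vertices joined by edges; the
  -- starting vertex is not fixed.
  record Play : Set where
    field
      at   : ℕ → V
      edge : ∀ i → E (at i) (at (suc i))

  -- σ (w · v) is  next w v v∈P , with w in chronological order.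
  record Strategy (P : Subset ∣V∣) : Set where
    field
      next  : List V → (v : V) → v ∈ P → V
      legal : ∀ w v v∈P → E v (next w v v∈P)

  EveStrategy AdamStrategy : Set
  EveStrategy  = Strategy V∘
  AdamStrategy = Strategy V□

module _ {𝒜 : Arena} where
  open Arena 𝒜
  open Strategy

  module _ (v₀ : V) (σ : EveStrategy 𝒜) (τ : AdamStrategy 𝒜) where

    move : (w : List V) (v : V) → ∃[ u ] E v u
    move w v with v ∈? V∘
    ... | yes v∈V∘ = next σ w v v∈V∘ , legal σ w v v∈V∘
    ... | no  v∉V∘ = let v∈V□ = x∉p⇒x∈∁p v∉V∘ in
                     next τ w v v∈V□ , legal τ w v v∈V□

    -- The vertices strictly before time i, and the vertex at time i.
    past    : ℕ → List V
    current : ℕ → V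

    past zero      = []
    past (suc i) = past i ∷ʳ current i

    current zero      = v₀
    current (suc i) = proj₁ (move (past i) (current i))

    π : Play 𝒜
    π = record
      { at   = current
      ; edge = λ i → proj₂ (move (past i) (current i))
      }

record Game : Set₁ where
  constructor ⟨_,_⟩
  field
    arena : Arena
    Φ     : Pred (Play arena) 0ℓ

EveWins : (𝒢 : Game) → Arena.V (Game.arena 𝒢) → Set
EveWins ⟨ 𝒜 , Φ ⟩ v₀ =
  Σ[ σ ∈ EveStrategy 𝒜 ] ((τ : AdamStrategy 𝒜) → Φ (π v₀ σ τ))

GenReach : ∀ {𝒜 k} → Vec (Subset (Arena.∣V∣ 𝒜)) k → Pred (Play 𝒜) 0ℓ
GenReach F ρ = ∀ i → ∃[ p ] Play.at ρ p ∈ lookup F i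

record Instance : Set where
  field
    𝒜  : Arena
    k  : ℕ
    F  : Vec (Subset (Arena.∣V∣ 𝒜)) k
    v₀ : Arena.V 𝒜

  game : Game
  game = ⟨ 𝒜 , GenReach F ⟩

  AllSingletons : Set
  AllSingletons = ∀ i → ∃[ v ] lookup F i ≡ ⁅ v ⁆

Word : Set
Word = List Bool

unary : ℕ → Word
unary n = replicate n true ++ false ∷ []

rows : ∀ {m n} → Vec (Subset n) m → Word
rows M = concatMap toList (toList M)

-- 1ⁿ 0 1ᵏ 0 followed by a bit matrix with n columns: the characteristic
-- vector of V∘, the adjacency matrix, the characteristic vectors of
-- F₁, …, Fₖ, and the characteristic vector of {v₀}.  As every vertex
-- has a successor, there are at least n edges, so this is polynomially
-- related in length to encodings by adjacency lists.
encode : Instance → Word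
encode I =
  unary ∣V∣ ++ unary k ++
  toList V∘ ++ rows successors ++ rows F ++ toList ⁅ v₀ ⁆
  where
  open Instance I
  open Arena 𝒜

Language : Set₁
Language = Pred Word 0ℓ

-- Words that encode no instance are not in the language.
language : Pred Instance 0ℓ → Language
language Yes w = ∃[ I ] encode I ≡ w × Yes I

data Symbol (Γ : Set) : Set where
  blank : Symbol Γ
  bit   : Bool → Symbol Γ
  aux   : Γ → Symbol Γ

data Direction : Set where
  left stay right : Direction

data Action (Q Γ : Set) (tapes : ℕ) : Set where
  halt : (accept : Bool) → Action Q Γ tapes
  go   : Q → Vec (Symbol Γ × Direction) tapes → Action Q Γ tapes

record TuringMachine : Set₁ where
  field
    Q Γ       : Set
    Q-finite  : ∃[ n ] Q ↔ Fin n
    Γ-finite  : ∃[ n ] Γ ↔ Fin n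
    workTapes : ℕ

  tapes : ℕ
  tapes = suc workTapes

  field
    start : Q
    δ     : Q → Vec (Symbol Γ) tapes → Action Q Γ tapes

-- A two-way infinite tape.  Both lists are read outwards from the head,
-- and every cell beyond their ends is blank.
record Tape (Γ : Set) : Set where
  constructor tape
  field
    before : List (Symbol Γ)
    head   : Symbol Γ
    after  : List (Symbol Γ)

module _ {Γ : Set} where

  emptyTape : Tape Γ
  emptyTape = tape [] blank []

  inputTape : Word → Tape Γ
  inputTape []      = emptyTape
  inputTape (b ∷ w) = tape [] (bit b) (map bit w)

  shift : Direction → Tape Γ → Tape Γ
  shift stay  t                     = t
  shift left  (tape []       x rs)  = tape [] blank (x ∷ rs)
  shift left  (tape (l ∷ ls) x rs)  = tape ls l (x ∷ rs)
  shift right (tape ls x [])        = tape (x ∷ ls) blank []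
  shift right (tape ls x (r ∷ rs))  = tape (x ∷ ls) r rs

  act : Symbol Γ × Direction → Tape Γ → Tape Γ
  act (x , d) (tape ls _ rs) = shift d (tape ls x rs)

module _ (M : TuringMachine) where
  open TuringMachine M

  -- The verdict if the machine halts within the given number of steps.
  run : ℕ → Q → Vec (Tape Γ) tapes → Maybe Bool
  run zero      q ts = nothing
  run (suc t) q ts with δ q (Vec.map Tape.head ts)
  ... | halt b       = just b
  ... | go q′ writes = run t q′ (Vec.zipWith act writes ts)

  runOn : ℕ → Word → Maybe Bool
  runOn t w = run t start (inputTape w Vec.∷ Vec.replicate workTapes emptyTape)

  DecidesInTime : (ℕ → ℕ) → Language → Set
  DecidesInTime T L =
    ∀ w → ∃[ b ] runOn (T (length w)) w ≡ just b × (b ≡ true ⇔ L w)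

PTIME : Pred Language (Level.suc 0ℓ)
PTIME L =
  Σ[ M ∈ TuringMachine ] ∃[ c ] ∃[ d ]
    DecidesInTime M (λ n → c * n ^ d + c) L

{-# OPTIONS --safe #-}

-- Write tᵢ for the only vertex of Fᵢ and Attr t for the set of vertices from which Eve can
-- force a visit to t.  Eve wins from v₀ iff for all i and j, v₀ ∈ Attr tᵢ, and tᵢ ∈ Attr tⱼ
-- or tⱼ ∈ Attr tᵢ.  Under this condition the preorder "x ∈ Attr y" on the targets is total,
-- and Eve always heads for a least unvisited target.  If tᵢ and tⱼ are incomparable, Adam
-- waits until one of them is visited and from then on stays out of the attractor of the other.
-- Attractors are computed by n rounds of one-step enlargement.  The Turing machine is compiled
-- from a program of nested loops over tapes with at most quadratically many cells, so its
-- running time is bounded by a polynomial read off the program.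
module Submission where

open import Defs
open import Data.Bool using (Bool; true; false; if_then_else_; not; _∧_; _∨_)
open import Data.Bool.Properties using (¬-not; ∨-zeroʳ; ∨-identityʳ)
open import Data.Empty using (⊥; ⊥-elim)
open import Data.Fin using (Fin; zero; suc; #_)
open import Data.Fin.Patterns
open import Data.Fin.Properties using (0↔⊥; 1↔⊤; +↔⊎; _≟_; any?)
open import Data.Fin.Subset using (Subset; _∈_; _∉_; _⊆_; ∁; ⁅_⁆; ∣_∣; Nonempty) renaming (⊥ to ∅)
open import Data.Fin.Subset.Properties using
  (_∈?_; ∣p∣≤n; p⊂q⇒∣p∣<∣q∣; x∈p∪q⁻; p⊆p∪q; q⊆p∪q; ⊆-antisym; x∈⁅x⁆; x∈⁅y⁆⇒x≡y; x∈∁p⇒x∉p; x∉p⇒x∈∁p)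
open import Data.List as List using
  (List; []; _∷_; _++_; _∷ʳ_; _ʳ++_; length; drop; filter; foldl)
open import Data.List.Membership.DecPropositional using () renaming (_∈?_ to ∈ₗ?)
open import Data.List.Membership.Propositional using () renaming (_∈_ to _∈ₗ_)
open import Data.List.Membership.Propositional.Properties using
  (∈-filter⁺; ∈-filter⁻; ∈-tabulate⁺; ∈-tabulate⁻)
open import Data.List.Properties using
  (++-assoc; ++-identityʳ; ++-ʳ++; ʳ++-ʳ++; length-ʳ++; length-++; foldl-∷ʳ; filter-all; filter-notAll)
open import Data.List.Relation.Unary.All as ListAll using ()
open import Data.List.Relation.Unary.Any as Any using ()
open import Data.Maybe as Maybe using (Maybe; just; nothing; maybe)
open import Data.Maybe.Properties using (just-injective)
open import Data.Nat using (ℕ; zero; suc; _+_; _*_; _∸_; _^_; _⊔_; _≤_; _<_; z≤n; s≤s)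
open import Data.Nat.Properties hiding (_≟_)
open import Data.Product using (∃-syntax; _×_; _,_; proj₁; proj₂; map₁)
open import Data.Sum using (_⊎_; inj₁; inj₂)
open import Data.Sum.Function.Propositional using (_⊎-↔_)
open import Data.Unit using (⊤; tt)
open import Data.Vec as Vec using (Vec; []; _∷_; lookup; toList; zipWith; _[_]≔_; here; there)
open import Data.Vec.Properties using
  ([]=⇒lookup; lookup⇒[]=; []≔-idempotent; []≔-commutes; []≔-lookup; lookup∘update; lookup∘update′;
   lookup-map; lookup-zipWith; map-∘; map-cong; length-toList)
open import Data.Vec.Relation.Unary.All using (All; []; _∷_)
open import Data.Vec.Relation.Unary.AllPairs using (allPairs?; []; _∷_)
open import Data.Vec.Relation.Unary.Unique.Propositional using (Unique)
open import Function using (_∘_; const)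
open import Function.Bundles using (_↔_; _⇔_; mk↔ₛ′; mk⇔; Equivalence; Inverse)
open import Function.Construct.Composition using (_↔-∘_)
open import Function.Construct.Symmetry using (↔-sym)
open import Relation.Binary.PropositionalEquality
open import Relation.Nullary using (¬_; Dec; yes; no; ¬?; contradiction)
open import Relation.Nullary.Decidable using (True; toWitness; _×-dec_)

-- Structured multitape programs and their compilation to Turing machines

-- Because every Fᵢ is a single vertex, it is known in advance where the play stands when a target
-- is first visited. So "tⱼ can still be forced after tᵢ" is the pairwise condition tᵢ ∈ Attr tⱼ,
-- and since attractors compose (`Attr-trans`), pairwise conditions suffice for any number of
-- targets. On the machine side the obstacle is that words encoding no instance must be rejected
-- within the same time bound. No run is cut short for this: all defects are gathered in one flag
-- that is never cleared once reading has begun, blanks are read as zeros, and after the two unary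
-- numbers every loop is steered by tapes that the machine itself has written. The run is thus
-- described for arbitrary words, and that a word is an encoding is recovered afterwards from the
-- flag still being false.

Sym : Set
Sym = Symbol ⊥

Tp : Set
Tp = Tape ⊥

Tapes : ℕ → Set
Tapes = Vec Tp

heads : ∀ {m} → Tapes m → Vec Sym m
heads = Vec.map Tape.head

infixr 5 _⨾_

-- A case distinction goes into the written symbol, which may depend on all scanned symbols, so
-- sequence and loop are the only control flow.
data Prog (m : ℕ) : Set where
  op              : Fin m → (Vec Sym m → Sym) → Direction → Prog m
  _⨾_             : Prog m → Prog m → Prog m
  while           : (Vec Sym m → Bool) → Prog m → Prog m

-- Every loop may run at most B times; this makes the running time a function of
-- the program text and B.
module Execution (B : ℕ) where

  infix 4 _⊢_⇓_

  mutual
    data _⊢_⇓_ {m : ℕ} : Prog m → Tapes m → Tapes m → Set where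
      -- The new tape is a variable with an equation, because a shift does not reduce until it is
      -- known whether the list beyond the head is empty; lemmas such as `overwrite` supply the
      -- equation.
      step : ∀ {x f d ts t} →
             act (f (heads ts) , d) (lookup ts x) ≡ t →
             op x f d ⊢ ts ⇓ ts [ x ]≔ t
      _⨾_  : ∀ {P Q ts₁ ts₂ ts₃} →
             P ⊢ ts₁ ⇓ ts₂ → Q ⊢ ts₂ ⇓ ts₃ → P ⨾ Q ⊢ ts₁ ⇓ ts₃
      loop : ∀ {c P i ts₁ ts₂} → i ≤ B → Loop c P i ts₁ ts₂ →
             while c P ⊢ ts₁ ⇓ ts₂

    data Loop {m : ℕ} (c : Vec Sym m → Bool) (P : Prog m) :
              ℕ → Tapes m → Tapes m → Set where
      exit : ∀ {ts} → c (heads ts) ≡ false → Loop c P 0 ts ts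
      iter : ∀ {i ts₁ ts₂ ts₃} → c (heads ts₁) ≡ true →
             P ⊢ ts₁ ⇓ ts₂ → Loop c P i ts₂ ts₃ → Loop c P (suc i) ts₁ ts₃

-- A loop test costs one step. Each of at most `B` iterations pays for its test and its body, and
-- the final 1 is the failing test.
time : ∀ {m} → Prog m → ℕ → ℕ
time (op _ _ _)  B = 1
time (P ⨾ Q)     B = time P B + time Q B
time (while _ P) B = B * (1 + time P B) + 1

-- One state for each operation and one for each loop test. The end of a program is not a state of
-- its own, so sequencing costs no step.
States : ∀ {m} → Prog m → Set
States (op _ _ _)  = ⊤
States (P ⨾ Q)     = States P ⊎ States Q
States (while _ P) = ⊤ ⊎ States P

states-finite : ∀ {m} (P : Prog m) → ∃[ n ] States P ↔ Fin n
states-finite (op _ _ _)  = 1 , ↔-sym 1↔⊤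
states-finite (P ⨾ Q)     =
  let m , f = states-finite P; n , g = states-finite Q
  in m + n , ↔-sym +↔⊎ ↔-∘ (f ⊎-↔ g)
states-finite (while _ P) =
  let n , f = states-finite P in 1 + n , ↔-sym +↔⊎ ↔-∘ (↔-sym 1↔⊤ ⊎-↔ f)

Maybe-finite : ∀ {A : Set} → ∃[ n ] A ↔ Fin n → ∃[ n ] Maybe A ↔ Fin n
Maybe-finite {A} (n , f) = suc n , mk↔ₛ′ to from to∘from from∘to
  where
  to : Maybe A → Fin (suc n)
  to nothing  = zero
  to (just a) = suc (Inverse.to f a)
  from : Fin (suc n) → Maybe A
  from zero    = nothing
  from (suc i) = just (Inverse.from f i)
  to∘from : ∀ i → to (from i) ≡ i
  to∘from zero    = refl
  to∘from (suc i) = cong suc (Inverse.inverseˡ f refl)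
  from∘to : ∀ a → from (to a) ≡ a
  from∘to nothing  = refl
  from∘to (just a) = cong just (Inverse.inverseʳ f refl)

entry : ∀ {m} (P : Prog m) → States P
entry (op _ _ _)  = tt
entry (P ⨾ Q)     = inj₁ (entry P)
entry (while _ P) = inj₁ tt

idle : ∀ {m} → Vec Sym m → Vec (Sym × Direction) m
idle = Vec.map (_, stay)

-- The state nothing is the exit of the program.
control : ∀ {m} (P : Prog m) → States P → Vec Sym m →
          Maybe (States P) × Vec (Sym × Direction) m
control (op x f d)  tt       h = nothing , idle h [ x ]≔ (f h , d)
control (P ⨾ Q)     (inj₁ p) h = map₁ (just ∘ maybe inj₁ (inj₂ (entry Q))) (control P p h)
control (P ⨾ Q)     (inj₂ q) h = map₁ (Maybe.map inj₂) (control Q q h)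
control (while c P) (inj₁ tt) h =
  (if c h then just (inj₂ (entry P)) else nothing) , idle h
control (while c P) (inj₂ p) h = map₁ (just ∘ maybe inj₂ (inj₁ tt)) (control P p h)

zipWith-act-idle : ∀ {m} (ts : Tapes m) →
                   Vec.zipWith act (idle (heads ts)) ts ≡ ts
zipWith-act-idle []       = refl
zipWith-act-idle (t ∷ ts) = cong (t ∷_) (zipWith-act-idle ts)

zipWith-act-≔ : ∀ {m} (ts : Tapes m) x a →
                Vec.zipWith act (idle (heads ts) [ x ]≔ a) ts ≡
                ts [ x ]≔ act a (lookup ts x)
zipWith-act-≔ (t ∷ ts) zero    a = cong (act a t ∷_) (zipWith-act-idle ts)
zipWith-act-≔ (t ∷ ts) (suc x) a = cong (t ∷_) (zipWith-act-≔ ts x a)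

module Compilation {w} (P₀ : Prog (suc w)) (verdict : Vec Sym (suc w) → Bool) where

  machine : TuringMachine
  machine = record
    { Q         = Maybe (States P₀)
    ; Γ         = ⊥
    ; Q-finite  = Maybe-finite (states-finite P₀)
    ; Γ-finite  = 0 , ↔-sym 0↔⊥
    ; workTapes = w
    ; start     = just (entry P₀)
    ; δ         = maybe (λ p h → let q , a = control P₀ p h in go q a)
                        (λ h → halt (verdict h))
    }

  open TuringMachine machine using (δ)

  -- `e` places the states of `P` among those of the whole program; its value at `nothing` is the
  -- point where control continues after `P`.
  Embeds : (P : Prog (suc w)) → (Maybe (States P) → Maybe (States P₀)) → Set
  Embeds P e = ∀ p h → δ (e (just p)) h ≡
                       go (e (proj₁ (control P p h))) (proj₂ (control P p h))

  run-step : ∀ P e → Embeds P e → ∀ p ts t →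
             run machine (suc t) (e (just p)) ts ≡
             run machine t (e (proj₁ (control P p (heads ts))))
               (Vec.zipWith act (proj₂ (control P p (heads ts))) ts)
  run-step P e e-ok p ts t rewrite e-ok p (heads ts) = refl

  run-assoc : ∀ q ts s₁ s₂ t → run machine (s₁ + s₂ + t) q ts ≡ run machine (s₁ + (s₂ + t)) q ts
  run-assoc q ts s₁ s₂ t = cong (λ u → run machine u q ts) (+-assoc s₁ s₂ t)

  module _ {B : ℕ} where
    open Execution B

    -- The step count `s` is exact and the remaining fuel `t` arbitrary, so that simulations of
    -- consecutive pieces can be chained; the bound on `s` is carried alongside.
    Simulates : (P : Prog (suc w)) (e : Maybe (States P) → Maybe (States P₀)) →
                ℕ → States P → (ts ts′ : Tapes (suc w)) → Set
    Simulates P e bound p ts ts′ =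
      ∃[ s ] s ≤ bound ×
             (∀ t → run machine (s + t) (e (just p)) ts ≡ run machine t (e nothing) ts′)

    mutual
      simulates : ∀ {P ts ts′} → P ⊢ ts ⇓ ts′ → ∀ e → Embeds P e →
                  Simulates P e (time P B) (entry P) ts ts′
      simulates {op x f d} {ts} (step refl) e e-ok =
        1 , ≤-refl , λ t → trans (run-step (op x f d) e e-ok tt ts t)
          (cong (run machine t (e nothing)) (zipWith-act-≔ ts x (f (heads ts) , d)))
      simulates {P ⨾ Q} {ts} (d₁ ⨾ d₂) e e-ok =
        let s₁ , s₁≤ , run₁ = simulates d₁ (e ∘ just ∘ maybe inj₁ (inj₂ (entry Q)))
                                (λ p → e-ok (inj₁ p))
            s₂ , s₂≤ , run₂ = simulates d₂ (e ∘ Maybe.map inj₂) (λ q → e-ok (inj₂ q))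
        in s₁ + s₂ , +-mono-≤ s₁≤ s₂≤ , λ t →
           trans (run-assoc (e (just (entry (P ⨾ Q)))) ts s₁ s₂ t)
                 (trans (run₁ (s₂ + t)) (run₂ t))
      simulates {while c P} (loop i≤B l) e e-ok =
        let s , s≤ , run-l = simulates-loop l e e-ok
        in s , ≤-trans s≤ (+-monoˡ-≤ 1 (*-monoˡ-≤ (1 + time P B) i≤B)) , run-l

      simulates-loop : ∀ {c P i ts ts′} → Loop c P i ts ts′ →
                       ∀ e → Embeds (while c P) e →
                       Simulates (while c P) e (i * (1 + time P B) + 1) (inj₁ tt) ts ts′
      simulates-loop {c} {P} {ts = ts} (exit c≡f) e e-ok =
        1 , ≤-refl , λ t → trans (run-step (while c P) e e-ok (inj₁ tt) ts t)
          (cong₂ (run machine t)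
            (cong (λ b → e (if b then just (inj₂ (entry P)) else nothing)) c≡f)
            (zipWith-act-idle ts))
      simulates-loop {c} {P} {suc i} {ts} (iter c≡t d l) e e-ok =
        let s₁ , s₁≤ , run₁ = simulates d (e ∘ just ∘ maybe inj₂ (inj₁ tt))
                                (λ p → e-ok (inj₂ p))
            s₂ , s₂≤ , run₂ = simulates-loop l e e-ok
        in suc (s₁ + s₂) ,
           ≤-trans (s≤s (+-mono-≤ s₁≤ s₂≤))
                   (≤-reflexive (cong suc (sym (+-assoc (time P B) (i * (1 + time P B)) 1)))) ,
           λ t → trans (run-step (while c P) e e-ok (inj₁ tt) ts (s₁ + s₂ + t))
             (trans (cong₂ (run machine (s₁ + s₂ + t))
               (cong (λ b → e (if b then just (inj₂ (entry P)) else nothing)) c≡t)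
               (zipWith-act-idle ts))
             (trans (run-assoc (e (just (inj₂ (entry P)))) ts s₁ s₂ t)
                    (trans (run₁ (s₂ + t)) (run₂ t))))

    run-machine : ∀ {ts ts′ T} → P₀ ⊢ ts ⇓ ts′ → suc (time P₀ B) ≤ T →
                  run machine T (just (entry P₀)) ts ≡ just (verdict (heads ts′))
    run-machine {ts} {ts′} {T} d time<T =
      let s , s≤ , run-s = simulates d (λ p → p) (λ _ _ → refl)
          s<T = ≤-trans (s≤s s≤) time<T
          -- One step beyond `s` is reserved for the exit state, which halts; whatever fuel is left
          -- over is then irrelevant.
          r = T ∸ suc s
          T≡ : s + suc r ≡ T
          T≡ = trans (+-suc s r) (m+[n∸m]≡n s<T)
      in trans (cong (λ u → run machine u (just (entry P₀)) ts) (sym T≡)) (run-s (suc r))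

-- Polynomial bounds on running times

record Polynomial (f : ℕ → ℕ) : Set where
  constructor poly
  field
    coefficient exponent : ℕ
    bound : ∀ n → f n ≤ coefficient * (1 + n) ^ exponent

module _ where
  open ≤-Reasoning

  const-poly : ∀ c → Polynomial (λ _ → c)
  const-poly c = poly c 0 λ n → ≤-reflexive (sym (*-identityʳ c))

  -- Raising both terms to a common exponent needs a positive base, which is why bounds are powers
  -- of `1 + n` and not of `n`.
  +-poly : ∀ {f g} → Polynomial f → Polynomial g → Polynomial (λ n → f n + g n)
  +-poly {f} {g} (poly c d f≤) (poly c′ d′ g≤) = poly (c + c′) (d + d′) λ n → begin
    f n + g n
      ≤⟨ +-mono-≤ (f≤ n) (g≤ n) ⟩
    c * suc n ^ d + c′ * suc n ^ d′
      ≤⟨ +-mono-≤ (*-monoʳ-≤ c (^-monoʳ-≤ (suc n) (m≤m+n d d′)))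
                  (*-monoʳ-≤ c′ (^-monoʳ-≤ (suc n) (m≤n+m d′ d))) ⟩
    c * suc n ^ (d + d′) + c′ * suc n ^ (d + d′)
      ≡⟨ *-distribʳ-+ (suc n ^ (d + d′)) c c′ ⟨
    (c + c′) * suc n ^ (d + d′) ∎

  *-poly : ∀ {f g} → Polynomial f → Polynomial g → Polynomial (λ n → f n * g n)
  *-poly {f} {g} (poly c d f≤) (poly c′ d′ g≤) = poly (c * c′) (d + d′) λ n → begin
    f n * g n
      ≤⟨ *-mono-≤ (f≤ n) (g≤ n) ⟩
    (c * suc n ^ d) * (c′ * suc n ^ d′)
      ≡⟨ [m*n]*[o*p]≡[m*o]*[n*p] c (suc n ^ d) c′ (suc n ^ d′) ⟩
    (c * c′) * (suc n ^ d * suc n ^ d′)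
      ≡⟨ cong ((c * c′) *_) (^-distribˡ-+-* (suc n) d d′) ⟨
    (c * c′) * suc n ^ (d + d′) ∎

  id-poly : Polynomial (λ n → n)
  id-poly = poly 1 1 λ n → begin
    n                    ≤⟨ n≤1+n n ⟩
    suc n                ≡⟨ *-identityʳ (suc n) ⟨
    suc n ^ 1            ≡⟨ *-identityˡ (suc n ^ 1) ⟨
    1 * suc n ^ 1        ∎

  time-poly : ∀ {m} (P : Prog m) {B} → Polynomial B → Polynomial (λ n → time P (B n))
  time-poly (op _ _ _)  B-poly = const-poly 1
  time-poly (P ⨾ Q)     B-poly = +-poly (time-poly P B-poly) (time-poly Q B-poly)
  time-poly (while _ P) B-poly =
    +-poly (*-poly B-poly (+-poly (const-poly 1) (time-poly P B-poly))) (const-poly 1)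

  ^-distribʳ-* : ∀ d m n → (m * n) ^ d ≡ m ^ d * n ^ d
  ^-distribʳ-* zero    m n = refl
  ^-distribʳ-* (suc d) m n =
    trans (cong (m * n *_) (^-distribʳ-* d m n)) ([m*n]*[o*p]≡[m*o]*[n*p] m n (m ^ d) (n ^ d))

  2+n≤2*1+n : ∀ n → suc (suc n) ≤ 2 * suc n
  2+n≤2*1+n n = s≤s (≤-trans (s≤s (m≤m+n n (n + 0))) (≤-reflexive (sym (+-suc n (n + 0)))))

  -- (1 + n)^d ≤ 2^d n^d for n ≥ 1, and the value at n = 0 is paid by the constant term.
  polynomial-bound : ∀ {f} → Polynomial f → ∃[ c ] ∃[ d ] (∀ n → f n ≤ c * n ^ d + c)
  polynomial-bound {f} (poly c d f≤) = c * 2 ^ d , d , λ where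
    zero    → begin
      f 0                                  ≤⟨ f≤ 0 ⟩
      c * 1 ^ d                            ≤⟨ *-monoʳ-≤ c (^-monoˡ-≤ d (s≤s z≤n)) ⟩
      c * 2 ^ d                            ≤⟨ m≤n+m (c * 2 ^ d) _ ⟩
      c * 2 ^ d * 0 ^ d + c * 2 ^ d        ∎
    (suc n) → begin
      f (suc n)                            ≤⟨ f≤ (suc n) ⟩
      c * suc (suc n) ^ d                  ≤⟨ *-monoʳ-≤ c (^-monoˡ-≤ d (2+n≤2*1+n n)) ⟩
      c * (2 * suc n) ^ d                  ≡⟨ cong (c *_) (^-distribʳ-* d 2 (suc n)) ⟩
      c * (2 ^ d * suc n ^ d)              ≡⟨ *-assoc c (2 ^ d) (suc n ^ d) ⟨
      c * 2 ^ d * suc n ^ d                ≤⟨ m≤m+n _ (c * 2 ^ d) ⟩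
      c * 2 ^ d * suc n ^ d + c * 2 ^ d    ∎

polynomial-time : ∀ {w} (P : Prog (suc w)) (verdict : Vec Sym (suc w) → Bool)
                  {B : ℕ → ℕ} → Polynomial B → (answer : Word → Bool) →
                  (∀ x → ∃[ ts ] Execution._⊢_⇓_ (B (length x)) P
                                   (inputTape x ∷ Vec.replicate w emptyTape) ts ×
                                 verdict (heads ts) ≡ answer x) →
                  ∃[ M ] ∃[ c ] ∃[ d ]
                    ∀ x → runOn M (c * length x ^ d + c) x ≡ just (answer x)
polynomial-time P verdict B-poly answer correct =
  let c , d , bound = polynomial-bound (+-poly (const-poly 1) (time-poly P B-poly))
  in Compilation.machine P verdict , c , d , λ x →
     let ts , run , ts-answer = correct x
     in trans (Compilation.run-machine P verdict run (bound (length x))) (cong just ts-answer)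

-- Running a program on a selection of the tapes

embed : ∀ {m m′} → Vec (Fin m′) m → Prog m → Prog m′
embed ρ (op x f d)  = op (lookup ρ x) (λ h → f (Vec.map (lookup h) ρ)) d
embed ρ (P ⨾ Q)     = embed ρ P ⨾ embed ρ Q
embed ρ (while c P) = while (λ h → c (Vec.map (lookup h) ρ)) (embed ρ P)

pull : ∀ {m m′} → Vec (Fin m′) m → Tapes m′ → Tapes m
pull ρ ts = Vec.map (lookup ts) ρ

push : ∀ {m m′} → Vec (Fin m′) m → Tapes m → Tapes m′ → Tapes m′
push []      []      ts = ts
push (x ∷ ρ) (t ∷ v) ts = push ρ v ts [ x ]≔ t

pull-heads : ∀ {m m′} (ρ : Vec (Fin m′) m) ts →
             Vec.map (lookup (heads ts)) ρ ≡ heads (pull ρ ts)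
pull-heads ρ ts = trans (map-cong (λ x → lookup-map x Tape.head ts) ρ)
                        (map-∘ Tape.head (lookup ts) ρ)

push-pull : ∀ {m m′} (ρ : Vec (Fin m′) m) ts → push ρ (pull ρ ts) ts ≡ ts
push-pull []      ts = refl
push-pull (x ∷ ρ) ts = trans (cong (_[ x ]≔ lookup ts x) (push-pull ρ ts)) ([]≔-lookup ts x)

pull-≔-∉ : ∀ {m m′ x} {ρ : Vec (Fin m′) m} → All (x ≢_) ρ → ∀ t ts →
           pull ρ (ts [ x ]≔ t) ≡ pull ρ ts
pull-≔-∉ []          t ts = refl
pull-≔-∉ (x≢y ∷ x∉ρ) t ts =
  cong₂ _∷_ (lookup∘update′ (x≢y ∘ sym) ts t) (pull-≔-∉ x∉ρ t ts)

-- If two local tapes were the same global tape, one write would destroy the other; hence `Unique`.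
pull-push : ∀ {m m′} {ρ : Vec (Fin m′) m} → Unique ρ → ∀ v ts → pull ρ (push ρ v ts) ≡ v
pull-push {ρ = []}    []         []      ts = refl
pull-push {ρ = x ∷ ρ} (x∉ρ ∷ u) (t ∷ v) ts =
  cong₂ _∷_ (lookup∘update x (push ρ v ts) t)
            (trans (pull-≔-∉ x∉ρ t (push ρ v ts)) (pull-push u v ts))

lookup-push : ∀ {m m′} {ρ : Vec (Fin m′) m} → Unique ρ → ∀ v ts i →
              lookup (push ρ v ts) (lookup ρ i) ≡ lookup v i
lookup-push {ρ = ρ} u v ts i =
  trans (sym (lookup-map i (lookup (push ρ v ts)) ρ)) (cong (λ v → lookup v i) (pull-push u v ts))

lookup-All : ∀ {m m′} {x : Fin m′} {ρ : Vec (Fin m′) m} → All (x ≢_) ρ → ∀ i → x ≢ lookup ρ i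
lookup-All (x≢y ∷ _)   zero    = x≢y
lookup-All (_ ∷ x∉ρ) (suc i) = lookup-All x∉ρ i

push-≔ : ∀ {m m′} {ρ : Vec (Fin m′) m} → Unique ρ → ∀ v ts i t →
         push ρ v ts [ lookup ρ i ]≔ t ≡ push ρ (v [ i ]≔ t) ts
push-≔ {ρ = x ∷ ρ} _         (_ ∷ v) ts zero    t = []≔-idempotent (push ρ v ts) x
push-≔ {ρ = x ∷ ρ} (x∉ρ ∷ u) (s ∷ v) ts (suc i) t =
  trans ([]≔-commutes (push ρ v ts) x (lookup ρ i) (lookup-All x∉ρ i))
        (cong (_[ x ]≔ s) (push-≔ u v ts i t))

module Frames (B : ℕ) where
  open Execution B

  module _ {m m′ : ℕ} {ρ : Vec (Fin m′) m} (u : Unique ρ) (ts : Tapes m′) where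

    heads-push : ∀ v → Vec.map (lookup (heads (push ρ v ts))) ρ ≡ heads v
    heads-push v = trans (pull-heads ρ (push ρ v ts)) (cong heads (pull-push u v ts))

    mutual
      frame-push : ∀ {P v v′} → P ⊢ v ⇓ v′ → embed ρ P ⊢ push ρ v ts ⇓ push ρ v′ ts
      frame-push {op x f d} {v} (step refl) =
        subst (op _ _ _ ⊢ push ρ v ts ⇓_) (push-≔ u v ts x _)
          (step (cong₂ (λ h t → act (f h , d) t) (heads-push v) (lookup-push u v ts x)))
      frame-push (d₁ ⨾ d₂)    = frame-push d₁ ⨾ frame-push d₂
      frame-push (loop i≤B l) = loop i≤B (frame-loop l)

      frame-loop : ∀ {c P i v v′} → Loop c P i v v′ →
                   Loop (λ h → c (Vec.map (lookup h) ρ)) (embed ρ P) i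
                        (push ρ v ts) (push ρ v′ ts)
      frame-loop {c} {v = v} (exit c≡f)     = exit (trans (cong c (heads-push v)) c≡f)
      frame-loop {c} {v = v} (iter c≡t d l) =
        iter (trans (cong c (heads-push v)) c≡t) (frame-push d) (frame-loop l)

    -- A frame rule. All configurations of the embedded run have the form `push ρ v ts` with one
    -- fixed `ts`, so tapes outside `ρ` keep their contents; `push-pull` brings the initial
    -- configuration into this form.
    frame : ∀ {P v′} → P ⊢ pull ρ ts ⇓ v′ → embed ρ P ⊢ ts ⇓ push ρ v′ ts
    frame {P} {v′} d = subst (embed ρ P ⊢_⇓ push ρ v′ ts) (push-pull ρ ts) (frame-push d)

-- Tapes of bits and the attractor computation

isBit val : Sym → Bool
isBit (bit _) = true
isBit blank   = false
isBit (aux ())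
val (bit b) = b
val blank   = false
val (aux ())

hd : List Bool → Sym
hd []      = blank
hd (x ∷ _) = bit x

-- The closing blank is stored although cells beyond the list are blank anyway: a head that turns
-- there leaves it in the list, and tapes are compared as lists.
bits : List Bool → List Sym
bits xs = List.map bit xs ++ blank ∷ []

tl : List Bool → List Sym
tl []       = []
tl (_ ∷ xs) = bits xs

-- The bits reverse ls ++ xs between two blanks, with the head on the cell after reverse ls.
Z : List Bool → List Bool → Tp
Z ls xs = tape (bits ls) (hd xs) (tl xs)

flag : Bool → Tp
flag b = tape [] (bit b) []

overwrite : ∀ y ls x xs → act (bit y , right) (Z ls (x ∷ xs)) ≡ Z (y ∷ ls) xs
overwrite y ls x []      = refl
overwrite y ls x (_ ∷ _) = refl

unique? : ∀ {m n} (ρ : Vec (Fin m) n) → Dec (Unique ρ)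
unique? = allPairs? λ x y → ¬? (x ≟ y)

goRight goLeft : ∀ {m} → Fin m → Prog m
goRight x = op x (λ h → lookup h x) right
goLeft  x = op x (λ h → lookup h x) left

assign : ∀ {m} → Fin m → (Vec Sym m → Bool) → Prog m
assign x f = op x (bit ∘ f) stay

emit : ∀ {m} → Fin m → (Vec Sym m → Bool) → Prog m
emit x f = op x (bit ∘ f) right

clear : ∀ {m} → Fin m → Prog m
clear x = assign x (const false)

bitAt : ∀ {m} → Fin m → Vec Sym m → Bool
bitAt x h = isBit (lookup h x)

-- The first move is unconditional because the calling loops end on the blank behind the bits, where
-- the loop test would fail at once.
rewind : Prog 1
rewind = goLeft 0F ⨾ while (bitAt 0F) (goLeft 0F) ⨾ goRight 0F

rewindAt : ∀ {m} → Fin m → Prog m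
rewindAt x = embed (x ∷ []) rewind

copyCell : Prog 3
copyCell = emit 1F (λ h → val (lookup h 0F)) ⨾ goRight 0F ⨾ goRight 2F

-- Rows lie on the source tape without separators, so the unary counter on the third tape tells
-- where a row ends. The source is not rewound: its head is left at the next row.
copyRow : Prog 3
copyRow = while (bitAt 2F) copyCell ⨾ rewindAt 1F ⨾ rewindAt 2F

duplicateCell : Prog 2
duplicateCell = emit 1F (λ h → val (lookup h 0F)) ⨾ goRight 0F

duplicate : Prog 2
duplicate = while (bitAt 0F) duplicateCell ⨾ rewindAt 0F ⨾ rewindAt 1F

fillCell : Prog 2
fillCell = emit 0F (const false) ⨾ goRight 1F

fill : Prog 2
fill = while (bitAt 1F) fillCell ⨾ rewindAt 0F ⨾ rewindAt 1F

meetCell : Prog 3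
meetCell =
  assign 2F (λ { (t ∷ w ∷ d ∷ []) → val d ∨ (val t ∧ val w) }) ⨾
  goRight 0F ⨾ emit 1F (const false)

-- Reading the second tape also overwrites it with zeros, which prepares it for the next attractor.
meet : Prog 3
meet = clear 2F ⨾ while (bitAt 1F) meetCell ⨾ rewindAt 0F ⨾ rewindAt 1F

scanCell : Prog 4
scanCell =
  assign 2F (λ { (m ∷ w ∷ a ∷ c ∷ []) → val a ∨ (val m ∧ val w) }) ⨾
  assign 3F (λ { (m ∷ w ∷ a ∷ c ∷ []) → val c ∨ (val m ∧ not (val w)) }) ⨾
  goRight 0F ⨾ goRight 1F

scanRow : Prog 4
scanRow = while (bitAt 1F) scanCell ⨾ rewindAt 1F

uniteCell : Prog 2
uniteCell = emit 0F (λ { (w ∷ x ∷ []) → val w ∨ val x }) ⨾ emit 1F (const false)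

unite : Prog 2
unite = while (bitAt 0F) uniteCell ⨾ rewindAt 0F ⨾ rewindAt 1F

forceCell : Prog 6
forceCell =
  embed (# 1 ∷ # 2 ∷ # 4 ∷ # 5 ∷ []) scanRow ⨾
  emit 3F (λ { (o ∷ m ∷ w ∷ x ∷ a ∷ c ∷ []) → if val o then val a else not (val c) }) ⨾
  clear 4F ⨾ clear 5F ⨾ goRight 0F

-- Forced vertices are collected on a separate tape and united with the attractor only at the end,
-- so that all rows of one pass are judged against the same set.
pass : Prog 6
pass = while (bitAt 0F) forceCell ⨾
       rewindAt 0F ⨾ rewindAt 1F ⨾ rewindAt 3F ⨾ embed (# 2 ∷ # 3 ∷ []) unite

attractCell : Prog 7
attractCell = embed (# 1 ∷ # 2 ∷ # 3 ∷ # 4 ∷ # 5 ∷ # 6 ∷ []) pass ⨾ goRight 0F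

-- The unary n is reused as a counter of rounds; `Attr-closed` shows that n rounds are enough.
attract : Prog 7
attract = while (bitAt 0F) attractCell ⨾ rewindAt 0F

-- Tape names: I is the input, U and K hold n and k in unary, L copies K, O is V∘, M the adjacency
-- matrix, F the rows of F₁, …, Fₖ, G copies F, S is {v₀}, P and Q are the two rows under test,
-- W is the growing attractor, X the vertices to be added to it, A, C, D, E, H are flags, and
-- R is set once the input is rejected.

-- Tapes: P, Q, U, O, M, W, X, A, C, D.
probe : Prog 10
probe =
  embed (# 0 ∷ # 5 ∷ # 2 ∷ []) copyRow ⨾ rewindAt 0F ⨾
  embed (# 2 ∷ # 3 ∷ # 4 ∷ # 5 ∷ # 6 ∷ # 7 ∷ # 8 ∷ []) attract ⨾
  embed (# 1 ∷ # 5 ∷ # 9 ∷ []) meet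

-- Tapes: S, P, Q, U, O, M, W, X, A, C, D, E, H, R.
test : Prog 14
test =
  embed (# 1 ∷ # 0 ∷ # 3 ∷ # 4 ∷ # 5 ∷ # 6 ∷ # 7 ∷ # 8 ∷ # 9 ∷ # 10 ∷ []) probe ⨾
  embed (# 1 ∷ # 2 ∷ # 3 ∷ # 4 ∷ # 5 ∷ # 6 ∷ # 7 ∷ # 8 ∷ # 9 ∷ # 11 ∷ []) probe ⨾
  embed (# 2 ∷ # 1 ∷ # 3 ∷ # 4 ∷ # 5 ∷ # 6 ∷ # 7 ∷ # 8 ∷ # 9 ∷ # 12 ∷ []) probe ⨾
  assign (# 13)
    (λ { (_ ∷ _ ∷ _ ∷ _ ∷ _ ∷ _ ∷ _ ∷ _ ∷ _ ∷ _ ∷ d ∷ e ∷ h ∷ r ∷ []) →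
         val r ∨ not (val d ∧ (val e ∨ val h)) }) ⨾
  clear (# 10) ⨾ clear (# 11) ⨾ clear (# 12)

-- Tapes: L, G, then those of test.
testRow : Prog 16
testRow =
  embed (# 1 ∷ # 4 ∷ # 5 ∷ []) copyRow ⨾
  embed (# 2 ∷ # 3 ∷ # 4 ∷ # 5 ∷ # 6 ∷ # 7 ∷ # 8 ∷ # 9 ∷ # 10 ∷ # 11 ∷ # 12 ∷ # 13 ∷ # 14 ∷ # 15 ∷ []) test ⨾
  embed (# 4 ∷ # 5 ∷ []) fill ⨾ goRight 0F

-- The inner loop has its own copies of the counter and of the rows, because the heads of the outer
-- loop must stay where they are.
testRows : Prog 16
testRows = while (bitAt 0F) testRow ⨾ rewindAt 0F ⨾ rewindAt 1F

-- Tapes: K, F, then those of testRows.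
testPair : Prog 18
testPair =
  embed (# 1 ∷ # 5 ∷ # 7 ∷ []) copyRow ⨾
  embed (# 2 ∷ # 3 ∷ # 4 ∷ # 5 ∷ # 6 ∷ # 7 ∷ # 8 ∷ # 9 ∷ # 10 ∷ # 11 ∷ # 12 ∷ # 13 ∷ # 14 ∷ # 15 ∷ # 16 ∷ # 17 ∷ []) testRows ⨾
  embed (# 5 ∷ # 7 ∷ []) fill ⨾ goRight 0F

testPairs : Prog 18
testPairs = while (bitAt 0F) testPair

-- The Boolean functions computed by the programs

hits misses : ∀ {n} → Bool → Vec Bool n → Vec Bool n → Bool
hits   b []      []      = b
hits   b (x ∷ r) (y ∷ w) = hits (b ∨ (x ∧ y)) r w
misses b []      []      = b
misses b (x ∷ r) (y ∷ w) = misses (b ∨ (x ∧ not y)) r w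

-- The controllable predecessor of `w`: a vertex of Eve needs some successor in `w`, a vertex of
-- Adam must have none outside.
force : ∀ {m n} → Vec Bool m → Vec (Vec Bool n) m → Vec Bool n → Vec Bool m
force o M w = zipWith (λ b r → if b then hits false r w else not (misses false r w)) o M

enlarge : ∀ {n} → Vec Bool n → Vec (Vec Bool n) n → Vec Bool n → Vec Bool n
enlarge o M w = zipWith _∨_ w (force o M w)

enlargeBy : ∀ {n} → Vec Bool n → Vec (Vec Bool n) n → ℕ → Vec Bool n → Vec Bool n
enlargeBy o M zero    w = w
enlargeBy o M (suc i) w = enlargeBy o M i (enlarge o M w)

attractor : ∀ {n} → Vec Bool n → Vec (Vec Bool n) n → Vec Bool n → Vec Bool n
attractor {n} o M = enlargeBy o M n

forces : ∀ {n} → Vec Bool n → Vec (Vec Bool n) n → Vec Bool n → Vec Bool n → Bool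
forces o M q p = hits false q (attractor o M p)

compatible : ∀ {n} → Vec Bool n → Vec (Vec Bool n) n → (s p q : Vec Bool n) → Bool
compatible o M s p q = forces o M s p ∧ (forces o M q p ∨ forces o M p q)

clashes : ∀ {n k} → Vec Bool n → Vec (Vec Bool n) n →
          (s p : Vec Bool n) → Vec (Vec Bool n) k → Bool → Bool
clashes o M s p []      r = r
clashes o M s p (g ∷ G) r = clashes o M s p G (r ∨ not (compatible o M s p g))

-- Both lists are F₁, ..., Fₖ in the end. They are separate arguments because the recursion consumes
-- `F` while each of its rows meets the whole of `G`.
conflicts : ∀ {n i k} → Vec Bool n → Vec (Vec Bool n) n →
            Vec Bool n → Vec (Vec Bool n) i → Vec (Vec Bool n) k → Bool → Bool
conflicts o M s []      G r = r
conflicts o M s (f ∷ F) G r = conflicts o M s F G (clashes o M s f G r)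

falses : ∀ n → Vec Bool n
falses n = Vec.replicate n false

ones : ℕ → List Bool
ones n = toList (Vec.replicate n true)

length-rows : ∀ {m n} (M : Vec (Vec Bool n) m) → length (rows M) ≡ m * n
length-rows []      = refl
length-rows (r ∷ M) =
  trans (length-++ (toList r)) (cong₂ _+_ (length-toList r) (length-rows M))

infixr 5 _ʳ++ʳ_

-- This is `rows M ʳ++ ls` unfolded row by row, which lets the invariants of row loops hold by
-- computation.
_ʳ++ʳ_ : ∀ {m n} → Vec (Vec Bool n) m → List Bool → List Bool
[]      ʳ++ʳ ls = ls
(r ∷ M) ʳ++ʳ ls = M ʳ++ʳ (toList r ʳ++ ls)

ʳ++ʳ-rows : ∀ {m n} (M : Vec (Vec Bool n) m) ls → rows M ʳ++ ls ≡ M ʳ++ʳ ls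
ʳ++ʳ-rows []      ls = refl
ʳ++ʳ-rows (r ∷ M) ls = trans (++-ʳ++ (toList r)) (ʳ++ʳ-rows M (toList r ʳ++ ls))

-- Correctness of the programs

module Correct (B : ℕ) where
  open Execution B
  open Frames B

  -- For a concrete `ρ` distinctness is decided by evaluation, and `pull` and `push` compute, so the
  -- results of consecutive calls fit together definitionally.
  at : ∀ {m m′} (ρ : Vec (Fin m′) m) {_ : True (unique? ρ)} {P ts v′} →
       P ⊢ pull ρ ts ⇓ v′ → embed ρ P ⊢ ts ⇓ push ρ v′ ts
  at ρ {u} = frame (toWitness u) _

  rewind-loop : ∀ ls x xs →
    Loop (bitAt 0F) (goLeft 0F) (suc (length ls))
      (Z ls (x ∷ xs) ∷ []) (tape [] blank (bits (ls ʳ++ x ∷ xs)) ∷ [])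
  rewind-loop []       x xs = iter refl (step refl) (exit refl)
  rewind-loop (l ∷ ls) x xs = iter refl (step refl) (rewind-loop ls l (x ∷ xs))

  leave-start : ∀ xs → goRight 0F ⊢ tape [] blank (bits xs) ∷ [] ⇓ Z [] xs ∷ []
  leave-start []       = step refl
  leave-start (x ∷ xs) = step refl

  rewind-correct : ∀ ls xs → length ls ≤ B →
                   rewind ⊢ Z ls xs ∷ [] ⇓ Z [] (ls ʳ++ xs) ∷ []
  rewind-correct []       []       ≤B = step refl ⨾ loop ≤B (exit refl) ⨾ leave-start []
  rewind-correct []       (x ∷ xs) ≤B = step refl ⨾ loop ≤B (exit refl) ⨾ leave-start (x ∷ xs)
  rewind-correct (l ∷ ls) []       ≤B =
    step refl ⨾ loop ≤B (rewind-loop ls l []) ⨾ leave-start (ls ʳ++ l ∷ [])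
  rewind-correct (l ∷ ls) (x ∷ xs) ≤B =
    step refl ⨾ loop ≤B (rewind-loop ls l (x ∷ xs)) ⨾ leave-start (ls ʳ++ l ∷ x ∷ xs)

  rewind-home : ∀ xs → length xs ≤ B →
                rewind ⊢ Z (xs ʳ++ []) [] ∷ [] ⇓ Z [] xs ∷ []
  rewind-home xs ≤B =
    subst (λ ys → rewind ⊢ Z (xs ʳ++ []) [] ∷ [] ⇓ Z [] ys ∷ [])
      (trans (ʳ++-ʳ++ xs) (++-identityʳ xs))
      (rewind-correct (xs ʳ++ []) []
        (≤-trans (≤-reflexive (trans (length-ʳ++ xs) (+-identityʳ _))) ≤B))

  rewind-row : ∀ {n} (v : Vec Bool n) → n ≤ B →
               rewind ⊢ Z (toList v ʳ++ []) [] ∷ [] ⇓ Z [] (toList v) ∷ []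
  rewind-row v n≤B = rewind-home (toList v) (≤-trans (≤-reflexive (length-toList v)) n≤B)

  rewind-rows : ∀ {m n} (M : Vec (Vec Bool n) m) → m * n ≤ B →
                rewind ⊢ Z (M ʳ++ʳ []) [] ∷ [] ⇓ Z [] (rows M) ∷ []
  rewind-rows M ≤B =
    subst (λ ls → rewind ⊢ Z ls [] ∷ [] ⇓ Z [] (rows M) ∷ []) (ʳ++ʳ-rows M [])
      (rewind-home (rows M) (≤-trans (≤-reflexive (length-rows M)) ≤B))

  rewind-ones : ∀ n → n ≤ B → rewind ⊢ Z (ones n ʳ++ []) [] ∷ [] ⇓ Z [] (ones n) ∷ []
  rewind-ones n = rewind-row (Vec.replicate n true)

  copyRow-loop : ∀ {n} (r w : Vec Bool n) ls rest ds us →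
    Loop (bitAt 2F) copyCell n
      (Z ls (toList r ++ rest) ∷ Z ds (toList w) ∷ Z us (ones n) ∷ [])
      (Z (toList r ʳ++ ls) rest ∷ Z (toList r ʳ++ ds) [] ∷ Z (ones n ʳ++ us) [] ∷ [])
  copyRow-loop []      []      ls rest ds us = exit refl
  copyRow-loop (x ∷ r) (y ∷ w) ls rest ds us =
    iter refl (step (overwrite x ds y (toList w)) ⨾
               step (overwrite x ls x (toList r ++ rest)) ⨾
               step (overwrite true us true (ones _)))
      (copyRow-loop r w (x ∷ ls) rest (x ∷ ds) (true ∷ us))

  copyRow-correct : ∀ {n} (r w : Vec Bool n) ls rest → n ≤ B →
    copyRow ⊢ Z ls (toList r ++ rest) ∷ Z [] (toList w) ∷ Z [] (ones n) ∷ []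
            ⇓ Z (toList r ʳ++ ls) rest ∷ Z [] (toList r) ∷ Z [] (ones n) ∷ []
  copyRow-correct {n} r w ls rest n≤B =
    loop n≤B (copyRow-loop r w ls rest [] []) ⨾
    at (1F ∷ []) (rewind-row r n≤B) ⨾ at (2F ∷ []) (rewind-ones n n≤B)

  duplicate-loop : ∀ xs ls ds →
    Loop (bitAt 0F) duplicateCell (length xs)
      (Z ls xs ∷ Z ds [] ∷ []) (Z (xs ʳ++ ls) [] ∷ Z (xs ʳ++ ds) [] ∷ [])
  duplicate-loop []       ls ds = exit refl
  duplicate-loop (x ∷ xs) ls ds =
    iter refl (step refl ⨾ step (overwrite x ls x xs)) (duplicate-loop xs (x ∷ ls) (x ∷ ds))

  duplicate-correct : ∀ xs → length xs ≤ B →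
    duplicate ⊢ Z [] xs ∷ Z [] [] ∷ [] ⇓ Z [] xs ∷ Z [] xs ∷ []
  duplicate-correct xs ≤B =
    loop ≤B (duplicate-loop xs [] []) ⨾
    at (0F ∷ []) (rewind-home xs ≤B) ⨾ at (1F ∷ []) (rewind-home xs ≤B)

  -- Here `fill` starts on an empty tape and every write extends it; `fill-loop` is the case of a
  -- row being overwritten.
  fillFresh-loop : ∀ n ds us →
    Loop (bitAt 1F) fillCell n
      (Z ds [] ∷ Z us (ones n) ∷ [])
      (Z (toList (falses n) ʳ++ ds) [] ∷ Z (ones n ʳ++ us) [] ∷ [])
  fillFresh-loop zero    ds us = exit refl
  fillFresh-loop (suc n) ds us =
    iter refl (step refl ⨾ step (overwrite true us true (ones n)))
      (fillFresh-loop n (false ∷ ds) (true ∷ us))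

  fillFresh-correct : ∀ n → n ≤ B →
    fill ⊢ Z [] [] ∷ Z [] (ones n) ∷ [] ⇓ Z [] (toList (falses n)) ∷ Z [] (ones n) ∷ []
  fillFresh-correct n n≤B =
    loop n≤B (fillFresh-loop n [] []) ⨾
    at (0F ∷ []) (rewind-row (falses n) n≤B) ⨾ at (1F ∷ []) (rewind-ones n n≤B)

  fill-loop : ∀ {n} (w : Vec Bool n) ds us →
    Loop (bitAt 1F) fillCell n
      (Z ds (toList w) ∷ Z us (ones n) ∷ [])
      (Z (toList (falses n) ʳ++ ds) [] ∷ Z (ones n ʳ++ us) [] ∷ [])
  fill-loop []      ds us = exit refl
  fill-loop (x ∷ w) ds us =
    iter refl (step (overwrite false ds x (toList w)) ⨾ step (overwrite true us true (ones _)))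
      (fill-loop w (false ∷ ds) (true ∷ us))

  fill-correct : ∀ {n} (w : Vec Bool n) → n ≤ B →
    fill ⊢ Z [] (toList w) ∷ Z [] (ones n) ∷ []
         ⇓ Z [] (toList (falses n)) ∷ Z [] (ones n) ∷ []
  fill-correct {n} w n≤B =
    loop n≤B (fill-loop w [] []) ⨾
    at (0F ∷ []) (rewind-row (falses n) n≤B) ⨾ at (1F ∷ []) (rewind-ones n n≤B)

  meet-loop : ∀ {n} (p w : Vec Bool n) b ps ws →
    Loop (bitAt 1F) meetCell n
      (Z ps (toList p) ∷ Z ws (toList w) ∷ flag b ∷ [])
      (Z (toList p ʳ++ ps) [] ∷ Z (toList (falses n) ʳ++ ws) [] ∷ flag (hits b p w) ∷ [])
  meet-loop []      []      b ps ws = exit refl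
  meet-loop (x ∷ p) (y ∷ w) b ps ws =
    iter refl (step refl ⨾ step (overwrite x ps x (toList p)) ⨾
               step (overwrite false ws y (toList w)))
      (meet-loop p w (b ∨ (x ∧ y)) (x ∷ ps) (false ∷ ws))

  meet-correct : ∀ {n} (p w : Vec Bool n) b → n ≤ B →
    meet ⊢ Z [] (toList p) ∷ Z [] (toList w) ∷ flag b ∷ []
         ⇓ Z [] (toList p) ∷ Z [] (toList (falses n)) ∷ flag (hits false p w) ∷ []
  meet-correct {n} p w b n≤B =
    step refl ⨾ loop n≤B (meet-loop p w false [] []) ⨾
    at (0F ∷ []) (rewind-row p n≤B) ⨾ at (1F ∷ []) (rewind-row (falses n) n≤B)

  scan-loop : ∀ {n} (r w : Vec Bool n) a c ls rest ws →
    Loop (bitAt 1F) scanCell n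
      (Z ls (toList r ++ rest) ∷ Z ws (toList w) ∷ flag a ∷ flag c ∷ [])
      (Z (toList r ʳ++ ls) rest ∷ Z (toList w ʳ++ ws) [] ∷
       flag (hits a r w) ∷ flag (misses c r w) ∷ [])
  scan-loop []      []      a c ls rest ws = exit refl
  scan-loop (x ∷ r) (y ∷ w) a c ls rest ws =
    iter refl (step refl ⨾ step refl ⨾ step (overwrite x ls x (toList r ++ rest)) ⨾
               step (overwrite y ws y (toList w)))
      (scan-loop r w (a ∨ (x ∧ y)) (c ∨ (x ∧ not y)) (x ∷ ls) rest (y ∷ ws))

  scan-correct : ∀ {n} (r w : Vec Bool n) ls rest → n ≤ B →
    scanRow ⊢ Z ls (toList r ++ rest) ∷ Z [] (toList w) ∷ flag false ∷ flag false ∷ []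
            ⇓ Z (toList r ʳ++ ls) rest ∷ Z [] (toList w) ∷
              flag (hits false r w) ∷ flag (misses false r w) ∷ []
  scan-correct r w ls rest n≤B =
    loop n≤B (scan-loop r w false false ls rest []) ⨾ at (1F ∷ []) (rewind-row w n≤B)

  unite-loop : ∀ {n} (w x : Vec Bool n) ws xs →
    Loop (bitAt 0F) uniteCell n
      (Z ws (toList w) ∷ Z xs (toList x) ∷ [])
      (Z (toList (zipWith _∨_ w x) ʳ++ ws) [] ∷ Z (toList (falses n) ʳ++ xs) [] ∷ [])
  unite-loop []      []      ws xs = exit refl
  unite-loop (y ∷ w) (z ∷ x) ws xs =
    iter refl (step (overwrite (y ∨ z) ws y (toList w)) ⨾ step (overwrite false xs z (toList x)))
      (unite-loop w x ((y ∨ z) ∷ ws) (false ∷ xs))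

  unite-correct : ∀ {n} (w x : Vec Bool n) → n ≤ B →
    unite ⊢ Z [] (toList w) ∷ Z [] (toList x) ∷ []
          ⇓ Z [] (toList (zipWith _∨_ w x)) ∷ Z [] (toList (falses n)) ∷ []
  unite-correct {n} w x n≤B =
    loop n≤B (unite-loop w x [] []) ⨾
    at (0F ∷ []) (rewind-row (zipWith _∨_ w x) n≤B) ⨾ at (1F ∷ []) (rewind-row (falses n) n≤B)

  -- The number `m` of remaining rows is kept apart from the row length `n`, since the induction
  -- strips rows of constant length.
  force-loop : ∀ {m n} (o : Vec Bool m) (M : Vec (Vec Bool n) m) w (x : Vec Bool m) os ms xs →
    n ≤ B →
    Loop (bitAt 0F) forceCell m
      (Z os (toList o) ∷ Z ms (rows M) ∷ Z [] (toList w) ∷ Z xs (toList x) ∷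
       flag false ∷ flag false ∷ [])
      (Z (toList o ʳ++ os) [] ∷ Z (M ʳ++ʳ ms) [] ∷ Z [] (toList w) ∷
       Z (toList (force o M w) ʳ++ xs) [] ∷ flag false ∷ flag false ∷ [])
  force-loop []      []      w []      os ms xs n≤B = exit refl
  force-loop (b ∷ o) (r ∷ M) w (y ∷ x) os ms xs n≤B =
    iter refl
      (at (# 1 ∷ # 2 ∷ # 4 ∷ # 5 ∷ []) (scan-correct r w ms (rows M) n≤B) ⨾
       step (overwrite _ xs y (toList x)) ⨾ step refl ⨾ step refl ⨾
       step (overwrite b os b (toList o)))
      (force-loop o M w x (b ∷ os) (toList r ʳ++ ms) (_ ∷ xs) n≤B)

  module _ {n : ℕ} (n≤B : n ≤ B) (n*n≤B : n * n ≤ B)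
           (o : Vec Bool n) (M : Vec (Vec Bool n) n) where

    pass-correct : ∀ w →
      pass ⊢ Z [] (toList o) ∷ Z [] (rows M) ∷ Z [] (toList w) ∷ Z [] (toList (falses n)) ∷
             flag false ∷ flag false ∷ []
           ⇓ Z [] (toList o) ∷ Z [] (rows M) ∷ Z [] (toList (enlarge o M w)) ∷
             Z [] (toList (falses n)) ∷ flag false ∷ flag false ∷ []
    pass-correct w =
      loop n≤B (force-loop o M w (falses n) [] [] [] n≤B) ⨾
      at (# 0 ∷ []) (rewind-row o n≤B) ⨾ at (# 1 ∷ []) (rewind-rows M n*n≤B) ⨾
      at (# 3 ∷ []) (rewind-row (force o M w) n≤B) ⨾
      at (# 2 ∷ # 3 ∷ []) (unite-correct w (force o M w) n≤B)

    attract-loop : ∀ i w us →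
      Loop (bitAt 0F) attractCell i
        (Z us (ones i) ∷ Z [] (toList o) ∷ Z [] (rows M) ∷ Z [] (toList w) ∷
         Z [] (toList (falses n)) ∷ flag false ∷ flag false ∷ [])
        (Z (ones i ʳ++ us) [] ∷ Z [] (toList o) ∷ Z [] (rows M) ∷
         Z [] (toList (enlargeBy o M i w)) ∷
         Z [] (toList (falses n)) ∷ flag false ∷ flag false ∷ [])
    attract-loop zero    w us = exit refl
    attract-loop (suc i) w us =
      iter refl
        (at (# 1 ∷ # 2 ∷ # 3 ∷ # 4 ∷ # 5 ∷ # 6 ∷ []) (pass-correct w) ⨾
         step (overwrite true us true (ones i)))
        (attract-loop i (enlarge o M w) (true ∷ us))

    attract-correct : ∀ w →
      attract ⊢ Z [] (ones n) ∷ Z [] (toList o) ∷ Z [] (rows M) ∷ Z [] (toList w) ∷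
                Z [] (toList (falses n)) ∷ flag false ∷ flag false ∷ []
              ⇓ Z [] (ones n) ∷ Z [] (toList o) ∷ Z [] (rows M) ∷
                Z [] (toList (attractor o M w)) ∷
                Z [] (toList (falses n)) ∷ flag false ∷ flag false ∷ []
    attract-correct w = loop n≤B (attract-loop n w []) ⨾ at (# 0 ∷ []) (rewind-ones n n≤B)

    -- The tapes U, O, M, W, X, A, C between any two probes.
    resting : Tapes 7
    resting =
      Z [] (ones n) ∷ Z [] (toList o) ∷ Z [] (rows M) ∷ Z [] (toList (falses n)) ∷
      Z [] (toList (falses n)) ∷ flag false ∷ flag false ∷ []

    probe-correct : ∀ p q d →
      probe ⊢ Z [] (toList p) ∷ Z [] (toList q) ∷ resting Vec.++ flag d ∷ []
            ⇓ Z [] (toList p) ∷ Z [] (toList q) ∷ resting Vec.++ flag (forces o M q p) ∷ []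
    probe-correct p q d =
      at (# 0 ∷ # 5 ∷ # 2 ∷ [])
        (subst (λ xs → copyRow ⊢ Z [] xs ∷ Z [] (toList (falses n)) ∷ Z [] (ones n) ∷ []
                               ⇓ Z (toList p ʳ++ []) [] ∷ Z [] (toList p) ∷ Z [] (ones n) ∷ [])
           (++-identityʳ (toList p)) (copyRow-correct p (falses n) [] [] n≤B)) ⨾
      at (# 0 ∷ []) (rewind-row p n≤B) ⨾
      at (# 2 ∷ # 3 ∷ # 4 ∷ # 5 ∷ # 6 ∷ # 7 ∷ # 8 ∷ []) (attract-correct p) ⨾
      at (# 1 ∷ # 5 ∷ # 9 ∷ []) (meet-correct q (attractor o M p) d n≤B)

    -- The three probes ask whether `s` meets the attractor of `p`, whether `q` does, and whether
    -- `p` meets that of `q`: the ingredients of `compatible`.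
    test-correct : ∀ s p q r →
      test ⊢ Z [] (toList s) ∷ Z [] (toList p) ∷ Z [] (toList q) ∷ resting Vec.++
             flag false ∷ flag false ∷ flag false ∷ flag r ∷ []
           ⇓ Z [] (toList s) ∷ Z [] (toList p) ∷ Z [] (toList q) ∷ resting Vec.++
             flag false ∷ flag false ∷ flag false ∷ flag (r ∨ not (compatible o M s p q)) ∷ []
    test-correct s p q r =
      at (# 1 ∷ # 0 ∷ # 3 ∷ # 4 ∷ # 5 ∷ # 6 ∷ # 7 ∷ # 8 ∷ # 9 ∷ # 10 ∷ []) (probe-correct p s false) ⨾
      at (# 1 ∷ # 2 ∷ # 3 ∷ # 4 ∷ # 5 ∷ # 6 ∷ # 7 ∷ # 8 ∷ # 9 ∷ # 11 ∷ []) (probe-correct p q false) ⨾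
      at (# 2 ∷ # 1 ∷ # 3 ∷ # 4 ∷ # 5 ∷ # 6 ∷ # 7 ∷ # 8 ∷ # 9 ∷ # 12 ∷ []) (probe-correct q p false) ⨾
      step refl ⨾ step refl ⨾ step refl ⨾ step refl

    testRow-correct : ∀ s p g r ls xs gs rest →
      testRow ⊢ Z ls (true ∷ xs) ∷ Z gs (toList g ++ rest) ∷
                Z [] (toList s) ∷ Z [] (toList p) ∷ Z [] (toList (falses n)) ∷ resting Vec.++
                flag false ∷ flag false ∷ flag false ∷ flag r ∷ []
              ⇓ Z (true ∷ ls) xs ∷ Z (toList g ʳ++ gs) rest ∷
                Z [] (toList s) ∷ Z [] (toList p) ∷ Z [] (toList (falses n)) ∷ resting Vec.++
                flag false ∷ flag false ∷ flag false ∷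
                flag (r ∨ not (compatible o M s p g)) ∷ []
    testRow-correct s p g r ls xs gs rest =
      at (# 1 ∷ # 4 ∷ # 5 ∷ []) (copyRow-correct g (falses n) gs rest n≤B) ⨾
      at (# 2 ∷ # 3 ∷ # 4 ∷ # 5 ∷ # 6 ∷ # 7 ∷ # 8 ∷ # 9 ∷ # 10 ∷ # 11 ∷ # 12 ∷ # 13 ∷ # 14 ∷ # 15 ∷ [])
        (test-correct s p g r) ⨾
      at (# 4 ∷ # 5 ∷ []) (fill-correct g n≤B) ⨾ step (overwrite true ls true xs)

    testRows-loop : ∀ {k} s p (G : Vec (Vec Bool n) k) r ls gs →
      Loop (bitAt 0F) testRow k
        (Z ls (ones k) ∷ Z gs (rows G) ∷
         Z [] (toList s) ∷ Z [] (toList p) ∷ Z [] (toList (falses n)) ∷ resting Vec.++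
         flag false ∷ flag false ∷ flag false ∷ flag r ∷ [])
        (Z (ones k ʳ++ ls) [] ∷ Z (G ʳ++ʳ gs) [] ∷
         Z [] (toList s) ∷ Z [] (toList p) ∷ Z [] (toList (falses n)) ∷ resting Vec.++
         flag false ∷ flag false ∷ flag false ∷ flag (clashes o M s p G r) ∷ [])
    testRows-loop s p []      r ls gs = exit refl
    testRows-loop s p (g ∷ G) r ls gs =
      iter refl (testRow-correct s p g r ls (ones _) gs (rows G))
        (testRows-loop s p G _ (true ∷ ls) (toList g ʳ++ gs))

    testRows-correct : ∀ {k} s p (G : Vec (Vec Bool n) k) r → k ≤ B → k * n ≤ B →
      testRows ⊢ Z [] (ones k) ∷ Z [] (rows G) ∷
                 Z [] (toList s) ∷ Z [] (toList p) ∷ Z [] (toList (falses n)) ∷ resting Vec.++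
                 flag false ∷ flag false ∷ flag false ∷ flag r ∷ []
               ⇓ Z [] (ones k) ∷ Z [] (rows G) ∷
                 Z [] (toList s) ∷ Z [] (toList p) ∷ Z [] (toList (falses n)) ∷ resting Vec.++
                 flag false ∷ flag false ∷ flag false ∷ flag (clashes o M s p G r) ∷ []
    testRows-correct {k} s p G r k≤B k*n≤B =
      loop k≤B (testRows-loop s p G r [] []) ⨾
      at (# 0 ∷ []) (rewind-ones k k≤B) ⨾ at (# 1 ∷ []) (rewind-rows G k*n≤B)

    testPair-correct : ∀ {k} s f (G : Vec (Vec Bool n) k) r ls xs fs rest → k ≤ B → k * n ≤ B →
      testPair ⊢ Z ls (true ∷ xs) ∷ Z fs (toList f ++ rest) ∷ Z [] (ones k) ∷ Z [] (rows G) ∷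
                 Z [] (toList s) ∷ Z [] (toList (falses n)) ∷ Z [] (toList (falses n)) ∷
                 resting Vec.++ flag false ∷ flag false ∷ flag false ∷ flag r ∷ []
               ⇓ Z (true ∷ ls) xs ∷ Z (toList f ʳ++ fs) rest ∷ Z [] (ones k) ∷ Z [] (rows G) ∷
                 Z [] (toList s) ∷ Z [] (toList (falses n)) ∷ Z [] (toList (falses n)) ∷
                 resting Vec.++ flag false ∷ flag false ∷ flag false ∷
                 flag (clashes o M s f G r) ∷ []
    testPair-correct s f G r ls xs fs rest k≤B k*n≤B =
      at (# 1 ∷ # 5 ∷ # 7 ∷ []) (copyRow-correct f (falses n) fs rest n≤B) ⨾
      at (# 2 ∷ # 3 ∷ # 4 ∷ # 5 ∷ # 6 ∷ # 7 ∷ # 8 ∷ # 9 ∷ # 10 ∷ # 11 ∷ # 12 ∷ # 13 ∷ # 14 ∷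
          # 15 ∷ # 16 ∷ # 17 ∷ [])
        (testRows-correct s f G r k≤B k*n≤B) ⨾
      at (# 5 ∷ # 7 ∷ []) (fill-correct f n≤B) ⨾ step (overwrite true ls true xs)

    testPairs-loop : ∀ {i k} s (F : Vec (Vec Bool n) i) (G : Vec (Vec Bool n) k) r ls fs →
      k ≤ B → k * n ≤ B →
      Loop (bitAt 0F) testPair i
        (Z ls (ones i) ∷ Z fs (rows F) ∷ Z [] (ones k) ∷ Z [] (rows G) ∷
         Z [] (toList s) ∷ Z [] (toList (falses n)) ∷ Z [] (toList (falses n)) ∷
         resting Vec.++ flag false ∷ flag false ∷ flag false ∷ flag r ∷ [])
        (Z (ones i ʳ++ ls) [] ∷ Z (F ʳ++ʳ fs) [] ∷ Z [] (ones k) ∷ Z [] (rows G) ∷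
         Z [] (toList s) ∷ Z [] (toList (falses n)) ∷ Z [] (toList (falses n)) ∷
         resting Vec.++ flag false ∷ flag false ∷ flag false ∷ flag (conflicts o M s F G r) ∷ [])
    testPairs-loop s []      G r ls fs k≤B k*n≤B = exit refl
    testPairs-loop s (f ∷ F) G r ls fs k≤B k*n≤B =
      iter refl (testPair-correct s f G r ls (ones _) fs (rows F) k≤B k*n≤B)
        (testPairs-loop s F G _ (true ∷ ls) (toList f ʳ++ fs) k≤B k*n≤B)

-- Reading the input

-- The input tape with w still to be read; its head never moves left, so ls is irrelevant.
Y : List Sym → List Bool → Tp
Y ls w = tape ls (hd w) (List.map bit (drop 1 w))

leading : List Bool → ℕ
leading (true ∷ w) = suc (leading w)
leading _          = 0

unterminated : List Bool → Bool
unterminated []          = true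
unterminated (false ∷ w) = false
unterminated (true ∷ w)  = unterminated w

atZero : List Sym → List Bool → Tp
atZero ls []          = Y ls []
atZero ls (false ∷ w) = Y ls (false ∷ w)
atZero ls (true ∷ w)  = atZero (bit true ∷ ls) w

-- After the block of ones the head moves right once more, over the terminating zero or, if the
-- input has ended, over a blank.
beforeUnary : List Sym → List Bool → List Sym
beforeUnary ls []          = blank ∷ ls
beforeUnary ls (false ∷ w) = bit false ∷ ls
beforeUnary ls (true ∷ w)  = beforeUnary (bit true ∷ ls) w

afterUnary : List Bool → List Bool
afterUnary []          = []
afterUnary (false ∷ w) = w
afterUnary (true ∷ w)  = afterUnary w

Y-right : ∀ ls x w → shift right (Y ls (x ∷ w)) ≡ Y (bit x ∷ ls) w
Y-right ls x []      = refl
Y-right ls x (_ ∷ _) = refl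

atZero-right : ∀ ls w → shift right (atZero ls w) ≡ Y (beforeUnary ls w) (afterUnary w)
atZero-right ls []          = refl
atZero-right ls (false ∷ w) = Y-right ls false w
atZero-right ls (true ∷ w)  = atZero-right (bit true ∷ ls) w

atZero-head : ∀ ls w → not (isBit (Tape.head (atZero ls w))) ≡ unterminated w
atZero-head ls []          = refl
atZero-head ls (false ∷ w) = refl
atZero-head ls (true ∷ w)  = atZero-head (bit true ∷ ls) w

-- Blanks count as zeros, so even a truncated input yields rows of the right length and later loops
-- need no special case; `short` records the defect.
bitsOf : ∀ n → Tp → Vec Bool n
bitsOf zero    t = []
bitsOf (suc n) t = val (Tape.head t) ∷ bitsOf n (shift right t)

skip : ℕ → Tp → Tp
skip zero    t = t
skip (suc n) t = skip n (shift right t)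

short : ℕ → Tp → Bool → Bool
short zero    t r = r
short (suc n) t r = short n (shift right t) (r ∨ not (isBit (Tape.head t)))

some : ∀ {n} → Bool → Vec Bool n → Bool
some a []      = a
some a (x ∷ v) = some (a ∨ x) v

-- The second flag needs the old value of the first, hence the order of the assignments in
-- `readCell`.
many : ∀ {n} → Bool → Bool → Vec Bool n → Bool
many a c []      = c
many a c (x ∷ v) = many (a ∨ x) (c ∨ (a ∧ x)) v

-- The arguments tell whether a row has at least one and at least two ones.
Defect : Set
Defect = Bool → Bool → Bool

rowFlag : Defect → ℕ → Tp → Bool → Bool
rowFlag bad n t r = short n t r ∨ bad (some false (bitsOf n t)) (many false false (bitsOf n t))

rowsOf : ∀ m n → Tp → Vec (Vec Bool n) m
rowsOf zero    n t = []
rowsOf (suc m) n t = bitsOf n t ∷ rowsOf m n (skip n t)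

skipRows : ℕ → ℕ → Tp → Tp
skipRows zero    n t = t
skipRows (suc m) n t = skipRows m n (skip n t)

rowsFlag : Defect → ℕ → ℕ → Tp → Bool → Bool
rowsFlag bad zero    n t r = r
rowsFlag bad (suc m) n t r = rowsFlag bad m n (skip n t) (rowFlag bad n t r)

readOne : Prog 3
readOne = emit 1F (const true) ⨾ goRight 0F

readUnary : Prog 3
readUnary =
  while (λ h → val (lookup h 0F)) readOne ⨾
  assign 2F (λ { (i ∷ t ∷ r ∷ []) → val r ∨ not (isBit i) }) ⨾ goRight 0F ⨾ rewindAt 1F

-- Tapes: I, T, U, A, C, R.
readCell : Prog 6
readCell =
  assign 4F (λ { (i ∷ t ∷ u ∷ a ∷ c ∷ r ∷ []) → val c ∨ (val a ∧ val i) }) ⨾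
  assign 3F (λ { (i ∷ t ∷ u ∷ a ∷ c ∷ r ∷ []) → val a ∨ val i }) ⨾
  assign 5F (λ { (i ∷ t ∷ u ∷ a ∷ c ∷ r ∷ []) → val r ∨ not (isBit i) }) ⨾
  emit 1F (λ h → val (lookup h 0F)) ⨾ goRight 0F ⨾ goRight 2F

readRow : Defect → Prog 6
readRow bad =
  while (bitAt 2F) readCell ⨾ rewindAt 2F ⨾
  assign 5F (λ { (i ∷ t ∷ u ∷ a ∷ c ∷ r ∷ []) → val r ∨ bad (val a) (val c) }) ⨾
  clear 3F ⨾ clear 4F

readLine : Defect → Prog 7
readLine bad = embed (# 1 ∷ # 2 ∷ # 3 ∷ # 4 ∷ # 5 ∷ # 6 ∷ []) (readRow bad) ⨾ goRight 0F

readRows : Defect → Prog 7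
readRows bad = while (bitAt 0F) (readLine bad)

-- Any row may describe V∘, an empty row of the adjacency matrix is a dead end, and the rows for the
-- Fᵢ and for v₀ must have exactly one 1.
arbitrary empty notSingleton : Defect
arbitrary    a c = false
empty        a c = not a
notSingleton a c = not a ∨ c

-- Tapes: I, K, F, L, G, S, P, Q, U, O, M, W, X, A, C, D, E, H, R.
openTapes : Prog 6
openTapes = goRight 0F ⨾ goRight 1F ⨾ goRight 2F ⨾ goRight 3F ⨾ goRight 4F ⨾ goRight 5F

clearFlags : Prog 6
clearFlags = clear 0F ⨾ clear 1F ⨾ clear 2F ⨾ clear 3F ⨾ clear 4F ⨾ clear 5F

initialise : Prog 19
initialise =
  embed (# 1 ∷ # 2 ∷ # 3 ∷ # 4 ∷ # 5 ∷ # 6 ∷ []) openTapes ⨾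
  embed (# 7 ∷ # 8 ∷ # 9 ∷ # 10 ∷ # 11 ∷ # 12 ∷ []) openTapes ⨾
  embed (# 13 ∷ # 14 ∷ # 15 ∷ # 16 ∷ # 17 ∷ # 18 ∷ []) clearFlags

readNumbers : Prog 19
readNumbers =
  embed (# 0 ∷ # 8 ∷ # 18 ∷ []) readUnary ⨾
  embed (# 0 ∷ # 1 ∷ # 18 ∷ []) readUnary ⨾
  embed (# 1 ∷ # 3 ∷ []) duplicate ⨾
  -- P, Q, W and X receive n zeros, the contents that every later test expects and restores.
  embed (# 6 ∷ # 8 ∷ []) fill ⨾ embed (# 7 ∷ # 8 ∷ []) fill ⨾
  embed (# 11 ∷ # 8 ∷ []) fill ⨾ embed (# 12 ∷ # 8 ∷ []) fill

readMatrices : Prog 19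
readMatrices =
  embed (# 0 ∷ # 9 ∷ # 8 ∷ # 13 ∷ # 14 ∷ # 18 ∷ []) (readRow arbitrary) ⨾ rewindAt (# 9) ⨾
  -- The row of V∘ counts the n rows of the matrix: the unary n is busy counting columns, and the
  -- loop test asks only whether a cell holds a bit, not which one.
  embed (# 9 ∷ # 0 ∷ # 10 ∷ # 8 ∷ # 13 ∷ # 14 ∷ # 18 ∷ []) (readRows empty) ⨾
  rewindAt (# 9) ⨾ rewindAt (# 10) ⨾
  embed (# 1 ∷ # 0 ∷ # 2 ∷ # 8 ∷ # 13 ∷ # 14 ∷ # 18 ∷ []) (readRows notSingleton) ⨾
  rewindAt (# 1) ⨾ rewindAt (# 2) ⨾ embed (# 2 ∷ # 4 ∷ []) duplicate ⨾
  embed (# 0 ∷ # 5 ∷ # 8 ∷ # 13 ∷ # 14 ∷ # 18 ∷ []) (readRow notSingleton) ⨾ rewindAt (# 5) ⨾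
  -- Bits left over after the last row also lead to rejection.
  assign (# 18) (λ h → val (lookup h (# 18)) ∨ isBit (lookup h 0F))

decider : Prog 19
decider =
  initialise ⨾ readNumbers ⨾ readMatrices ⨾
  embed (# 1 ∷ # 2 ∷ # 3 ∷ # 4 ∷ # 5 ∷ # 6 ∷ # 7 ∷ # 8 ∷ # 9 ∷ # 10 ∷ # 11 ∷ # 12 ∷ # 13 ∷
         # 14 ∷ # 15 ∷ # 16 ∷ # 17 ∷ # 18 ∷ []) testPairs

-- The tapes tᵢ are the input at successive stages of reading, and the rᵢ the values of R.
module Matrices (n k : ℕ) (t₂ : Tp) (r₂ : Bool) where
  o  = bitsOf n t₂
  t₃ = skip n t₂
  M  = rowsOf n n t₃
  t₄ = skipRows n n t₃
  F  = rowsOf k n t₄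
  t₅ = skipRows k n t₄
  s  = bitsOf n t₅
  t₆ = skip n t₅
  r₃ = rowFlag arbitrary n t₂ r₂
  r₄ = rowsFlag empty n n t₃ r₃
  r₅ = rowsFlag notSingleton k n t₄ r₄
  r₆ = rowFlag notSingleton n t₅ r₅
  r₇ = r₆ ∨ isBit (Tape.head t₆)
  rejects = conflicts o M s F F r₇

rejectsWord : List Bool → Bool
rejectsWord w =
  Matrices.rejects (leading w) (leading (afterUnary w))
    (Y (beforeUnary (beforeUnary [] w) (afterUnary w)) (afterUnary (afterUnary w)))
    (unterminated w ∨ unterminated (afterUnary w))

leading≤length : ∀ w → leading w ≤ length w
leading≤length []          = z≤n
leading≤length (false ∷ w) = z≤n
leading≤length (true ∷ w)  = s≤s (leading≤length w)

length-afterUnary : ∀ w → length (afterUnary w) ≤ length w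
length-afterUnary []          = z≤n
length-afterUnary (false ∷ w) = n≤1+n _
length-afterUnary (true ∷ w)  = m≤n⇒m≤1+n (length-afterUnary w)

module Reading (B : ℕ) where
  open Execution B
  open Correct B

  readUnary-loop : ∀ w ls r us →
    Loop (λ h → val (lookup h 0F)) readOne (leading w)
      (Y ls w ∷ Z us [] ∷ flag r ∷ [])
      (atZero ls w ∷ Z (ones (leading w) ʳ++ us) [] ∷ flag r ∷ [])
  readUnary-loop []          ls r us = exit refl
  readUnary-loop (false ∷ w) ls r us = exit refl
  readUnary-loop (true ∷ w)  ls r us =
    iter refl (step refl ⨾ step (Y-right ls true w))
      (readUnary-loop w (bit true ∷ ls) r (true ∷ us))

  readUnary-correct : ∀ w ls r → leading w ≤ B →
    readUnary ⊢ Y ls w ∷ Z [] [] ∷ flag r ∷ []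
              ⇓ Y (beforeUnary ls w) (afterUnary w) ∷ Z [] (ones (leading w)) ∷
                flag (r ∨ unterminated w) ∷ []
  readUnary-correct w ls r ≤B =
    loop ≤B (readUnary-loop w ls r []) ⨾
    step (cong (λ b → flag (r ∨ b)) (atZero-head ls w)) ⨾ step (atZero-right ls w) ⨾
    at (1F ∷ []) (rewind-ones (leading w) ≤B)

  readRow-loop : ∀ n t ts us a c r →
    Loop (bitAt 2F) readCell n
      (t ∷ Z ts [] ∷ Z us (ones n) ∷ flag a ∷ flag c ∷ flag r ∷ [])
      (skip n t ∷ Z (toList (bitsOf n t) ʳ++ ts) [] ∷ Z (ones n ʳ++ us) [] ∷
       flag (some a (bitsOf n t)) ∷ flag (many a c (bitsOf n t)) ∷ flag (short n t r) ∷ [])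
  readRow-loop zero    t ts us a c r = exit refl
  readRow-loop (suc n) t ts us a c r =
    iter refl
      (step refl ⨾ step refl ⨾ step refl ⨾ step refl ⨾ step refl ⨾
       step (overwrite true us true (ones n)))
      (readRow-loop n (shift right t) (val (Tape.head t) ∷ ts) (true ∷ us) _ _ _)

  readRow-correct : ∀ bad n t ts r → n ≤ B →
    readRow bad ⊢ t ∷ Z ts [] ∷ Z [] (ones n) ∷ flag false ∷ flag false ∷ flag r ∷ []
                ⇓ skip n t ∷ Z (toList (bitsOf n t) ʳ++ ts) [] ∷ Z [] (ones n) ∷
                  flag false ∷ flag false ∷ flag (rowFlag bad n t r) ∷ []
  readRow-correct bad n t ts r n≤B =
    loop n≤B (readRow-loop n t ts [] false false r) ⨾ at (2F ∷ []) (rewind-ones n n≤B) ⨾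
    step refl ⨾ step refl ⨾ step refl

  readRows-loop : ∀ bad n {m} (v : Vec Bool m) t ls ts r → n ≤ B →
    Loop (bitAt 0F) (readLine bad) m
      (Z ls (toList v) ∷ t ∷ Z ts [] ∷ Z [] (ones n) ∷ flag false ∷ flag false ∷ flag r ∷ [])
      (Z (toList v ʳ++ ls) [] ∷ skipRows m n t ∷ Z (rowsOf m n t ʳ++ʳ ts) [] ∷ Z [] (ones n) ∷
       flag false ∷ flag false ∷ flag (rowsFlag bad m n t r) ∷ [])
  readRows-loop bad n []      t ls ts r n≤B = exit refl
  readRows-loop bad n (x ∷ v) t ls ts r n≤B =
    iter refl
      (at (# 1 ∷ # 2 ∷ # 3 ∷ # 4 ∷ # 5 ∷ # 6 ∷ []) (readRow-correct bad n t ts r n≤B) ⨾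
       step (overwrite x ls x (toList v)))
      (readRows-loop bad n v (skip n t) (x ∷ ls) (toList (bitsOf n t) ʳ++ ts) _ n≤B)

  layout : (i k f l g s p q u o m w x : Tp) → Bool → Tapes 19
  layout i k f l g s p q u o m w x r =
    i ∷ k ∷ f ∷ l ∷ g ∷ s ∷ p ∷ q ∷ u ∷ o ∷ m ∷ w ∷ x ∷
    flag false ∷ flag false ∷ flag false ∷ flag false ∷ flag false ∷ flag r ∷ []

  e : Tp
  e = Z [] []

  -- A move to the right stores the left boundary blank that `Z` demands and that a fresh tape
  -- lacks.
  openTapes-correct : openTapes ⊢ Vec.replicate 6 emptyTape ⇓ Vec.replicate 6 e
  openTapes-correct =
    step refl ⨾ step refl ⨾ step refl ⨾ step refl ⨾ step refl ⨾ step refl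

  clearFlags-correct : clearFlags ⊢ Vec.replicate 6 emptyTape ⇓ Vec.replicate 6 (flag false)
  clearFlags-correct =
    step refl ⨾ step refl ⨾ step refl ⨾ step refl ⨾ step refl ⨾ step refl

  initialise-correct : ∀ t → initialise ⊢ t ∷ Vec.replicate 18 emptyTape
                                        ⇓ layout t e e e e e e e e e e e e false
  initialise-correct t =
    at (# 1 ∷ # 2 ∷ # 3 ∷ # 4 ∷ # 5 ∷ # 6 ∷ []) openTapes-correct ⨾
    at (# 7 ∷ # 8 ∷ # 9 ∷ # 10 ∷ # 11 ∷ # 12 ∷ []) openTapes-correct ⨾
    at (# 13 ∷ # 14 ∷ # 15 ∷ # 16 ∷ # 17 ∷ # 18 ∷ []) clearFlags-correct

  readNumbers-correct : ∀ w → let n = leading w; w₁ = afterUnary w; k = leading w₁ in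
    n ≤ B → k ≤ B →
    readNumbers ⊢ layout (Y [] w) e e e e e e e e e e e e false
      ⇓ layout (Y (beforeUnary (beforeUnary [] w) w₁) (afterUnary w₁)) (Z [] (ones k)) e (Z [] (ones k)) e e
          (Z [] (toList (falses n))) (Z [] (toList (falses n))) (Z [] (ones n)) e e
          (Z [] (toList (falses n))) (Z [] (toList (falses n)))
          (unterminated w ∨ unterminated w₁)
  readNumbers-correct w n≤B k≤B =
    at (# 0 ∷ # 8 ∷ # 18 ∷ []) (readUnary-correct w [] false n≤B) ⨾
    at (# 0 ∷ # 1 ∷ # 18 ∷ [])
      (readUnary-correct (afterUnary w) (beforeUnary [] w) (unterminated w) k≤B) ⨾
    at (# 1 ∷ # 3 ∷ []) (duplicate-correct (ones k)
      (≤-trans (≤-reflexive (length-toList (Vec.replicate k true))) k≤B)) ⨾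
    at (# 6 ∷ # 8 ∷ []) (fillFresh-correct n n≤B) ⨾
    at (# 7 ∷ # 8 ∷ []) (fillFresh-correct n n≤B) ⨾
    at (# 11 ∷ # 8 ∷ []) (fillFresh-correct n n≤B) ⨾
    at (# 12 ∷ # 8 ∷ []) (fillFresh-correct n n≤B)
    where
    n = leading w
    k = leading (afterUnary w)

  module _ (n k : ℕ) (n≤B : n ≤ B) (k≤B : k ≤ B) (n*n≤B : n * n ≤ B) (k*n≤B : k * n ≤ B)
           (t₂ : Tp) (r₂ : Bool) where
    open Matrices n k t₂ r₂

    zeros : Tp
    zeros = Z [] (toList (falses n))

    readMatrices-correct :
      readMatrices ⊢ layout t₂ (Z [] (ones k)) e (Z [] (ones k)) e e
                       zeros zeros (Z [] (ones n)) e e zeros zeros r₂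
        ⇓ layout t₆ (Z [] (ones k)) (Z [] (rows F)) (Z [] (ones k)) (Z [] (rows F)) (Z [] (toList s))
            zeros zeros (Z [] (ones n)) (Z [] (toList o)) (Z [] (rows M)) zeros zeros r₇
    readMatrices-correct =
      at (# 0 ∷ # 9 ∷ # 8 ∷ # 13 ∷ # 14 ∷ # 18 ∷ []) (readRow-correct arbitrary n t₂ [] r₂ n≤B) ⨾
      at (# 9 ∷ []) (rewind-row o n≤B) ⨾
      at (# 9 ∷ # 0 ∷ # 10 ∷ # 8 ∷ # 13 ∷ # 14 ∷ # 18 ∷ [])
        (loop n≤B (readRows-loop empty n o t₃ [] [] r₃ n≤B)) ⨾
      at (# 9 ∷ []) (rewind-row o n≤B) ⨾ at (# 10 ∷ []) (rewind-rows M n*n≤B) ⨾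
      at (# 1 ∷ # 0 ∷ # 2 ∷ # 8 ∷ # 13 ∷ # 14 ∷ # 18 ∷ [])
        (loop k≤B (readRows-loop notSingleton n (Vec.replicate k true) t₄ [] [] r₄ n≤B)) ⨾
      at (# 1 ∷ []) (rewind-ones k k≤B) ⨾ at (# 2 ∷ []) (rewind-rows F k*n≤B) ⨾
      at (# 2 ∷ # 4 ∷ [])
        (duplicate-correct (rows F) (≤-trans (≤-reflexive (length-rows F)) k*n≤B)) ⨾
      at (# 0 ∷ # 5 ∷ # 8 ∷ # 13 ∷ # 14 ∷ # 18 ∷ []) (readRow-correct notSingleton n t₅ [] r₅ n≤B) ⨾
      at (# 5 ∷ []) (rewind-row s n≤B) ⨾ step refl

    testPairs-correct : ∃[ ts ]
      embed (# 1 ∷ # 2 ∷ # 3 ∷ # 4 ∷ # 5 ∷ # 6 ∷ # 7 ∷ # 8 ∷ # 9 ∷ # 10 ∷ # 11 ∷ # 12 ∷ # 13 ∷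
             # 14 ∷ # 15 ∷ # 16 ∷ # 17 ∷ # 18 ∷ []) testPairs ⊢
        layout t₆ (Z [] (ones k)) (Z [] (rows F)) (Z [] (ones k)) (Z [] (rows F)) (Z [] (toList s))
          zeros zeros (Z [] (ones n)) (Z [] (toList o)) (Z [] (rows M)) zeros zeros r₇
        ⇓ ts × lookup ts (# 18) ≡ flag rejects
    testPairs-correct =
      _ , at (# 1 ∷ # 2 ∷ # 3 ∷ # 4 ∷ # 5 ∷ # 6 ∷ # 7 ∷ # 8 ∷ # 9 ∷ # 10 ∷ # 11 ∷ # 12 ∷ # 13 ∷
              # 14 ∷ # 15 ∷ # 16 ∷ # 17 ∷ # 18 ∷ [])
            (loop k≤B (testPairs-loop n≤B n*n≤B o M s F F r₇ [] [] k≤B k*n≤B)) , refl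

-- No loop runs longer than the longest tape, which holds at most |w|² cells.
loopBound : ℕ → ℕ
loopBound N = N * N + N

accepting : Vec Sym 19 → Bool
accepting h = not (val (lookup h (# 18)))

inputTape≡Y : ∀ w → inputTape w ≡ Y [] w
inputTape≡Y []      = refl
inputTape≡Y (_ ∷ _) = refl

module _ (w : List Bool) where
  open Execution (loopBound (length w))
  open Reading (loopBound (length w))

  private
    N = length w
    n≤N : leading w ≤ N
    n≤N = leading≤length w
    k≤N : leading (afterUnary w) ≤ N
    k≤N = ≤-trans (leading≤length (afterUnary w)) (length-afterUnary w)
    linear : ∀ {i} → i ≤ N → i ≤ loopBound N
    linear i≤N = ≤-trans i≤N (m≤n+m N (N * N))
    quadratic : ∀ {i j} → i ≤ N → j ≤ N → i * j ≤ loopBound N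
    quadratic i≤N j≤N = ≤-trans (*-mono-≤ i≤N j≤N) (m≤m+n (N * N) N)

  decider-correct : ∃[ ts ] decider ⊢ inputTape w ∷ Vec.replicate 18 emptyTape ⇓ ts ×
                            lookup ts (# 18) ≡ flag (rejectsWord w)
  decider-correct rewrite inputTape≡Y w =
    let ts , d , r = testPairs-correct _ _ (linear n≤N) (linear k≤N) (quadratic n≤N n≤N)
                       (quadratic k≤N n≤N) _ _
    in ts ,
       initialise-correct (Y [] w) ⨾ readNumbers-correct w (linear n≤N) (linear k≤N) ⨾
       readMatrices-correct _ _ (linear n≤N) (linear k≤N) (quadratic n≤N n≤N)
         (quadratic k≤N n≤N) _ _ ⨾ d ,
       r

decided-in-polynomial-time : ∃[ M ] ∃[ c ] ∃[ d ] ∀ w →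
  runOn M (c * length w ^ d + c) w ≡ just (not (rejectsWord w))
decided-in-polynomial-time =
  polynomial-time decider accepting (+-poly (*-poly id-poly id-poly) id-poly)
    (λ w → not (rejectsWord w)) λ w →
    let ts , run , r = decider-correct w
    in ts , run , cong not (trans (cong val (lookup-map (# 18) Tape.head ts))
                                  (cong (val ∘ Tape.head) r))

-- Attractors and strategies

hits-true : ∀ {n} (r w : Vec Bool n) → hits true r w ≡ true
hits-true []      []      = refl
hits-true (x ∷ r) (y ∷ w) = hits-true r w

hits⁺ : ∀ {n} b {r w : Subset n} {u} → u ∈ r → u ∈ w → hits b r w ≡ true
hits⁺ b {true ∷ r} {true ∷ w} here here rewrite ∨-zeroʳ b = hits-true r w
hits⁺ b {x ∷ r} {y ∷ w} (there u∈r) (there u∈w) = hits⁺ (b ∨ (x ∧ y)) u∈r u∈w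

hits⁻ : ∀ {n} b (r w : Subset n) → hits b r w ≡ true → b ≡ true ⊎ ∃[ u ] u ∈ r × u ∈ w
hits⁻ b     []          []          h = inj₁ h
hits⁻ true  (x ∷ r)     (y ∷ w)     h = inj₁ refl
hits⁻ false (true ∷ r)  (true ∷ w)  h = inj₂ (zero , here , here)
hits⁻ false (true ∷ r)  (false ∷ w) h with hits⁻ false r w h
... | inj₂ (u , u∈r , u∈w) = inj₂ (suc u , there u∈r , there u∈w)
hits⁻ false (false ∷ r) (y ∷ w)     h with hits⁻ false r w h
... | inj₂ (u , u∈r , u∈w) = inj₂ (suc u , there u∈r , there u∈w)

misses≡hits-∁ : ∀ {n} b (r w : Subset n) → misses b r w ≡ hits b r (∁ w)
misses≡hits-∁ b []      []      = refl
misses≡hits-∁ b (x ∷ r) (y ∷ w) = misses≡hits-∁ (b ∨ (x ∧ not y)) r w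

module Attractors {n : ℕ} (o : Subset n) (M : Vec (Subset n) n) where

  private
    V = Fin n

  E : V → V → Set
  E v u = u ∈ lookup M v

  Forced : Subset n → V → Set
  Forced w v = v ∈ o × (∃[ u ] E v u × u ∈ w) ⊎ v ∉ o × (∀ u → E v u → u ∈ w)

  lookup-force : ∀ w v → lookup (force o M w) v ≡
                 (if lookup o v then hits false (lookup M v) w
                                else not (misses false (lookup M v) w))
  lookup-force w v = lookup-zipWith _ v o M

  force⁻ : ∀ w v → v ∈ force o M w → Forced w v
  force⁻ w v v∈ with lookup o v in o≡ | trans (sym (lookup-force w v)) ([]=⇒lookup v∈)
  ... | true  | h with hits⁻ false (lookup M v) w h
  ...   | inj₂ u = inj₁ (lookup⇒[]= v o o≡ , u)
  force⁻ w v v∈ | false | h =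
    inj₂ ((λ v∈o → contradiction (trans (sym o≡) ([]=⇒lookup v∈o)) λ ()) , forced)
    where
    forced : ∀ u → E v u → u ∈ w
    forced u u∈r with u ∈? w
    ... | yes u∈w = u∈w
    ... | no  u∉w = contradiction
      (trans (sym h) (cong not (trans (misses≡hits-∁ false (lookup M v) w)
                                      (hits⁺ false u∈r (x∉p⇒x∈∁p u∉w)))))
      λ ()

  force⁺ : ∀ w v → Forced w v → v ∈ force o M w
  force⁺ w v (inj₁ (v∈o , u , u∈r , u∈w)) =
    lookup⇒[]= v _ (trans (lookup-force w v)
      (trans (cong (if_then _ else _) ([]=⇒lookup v∈o)) (hits⁺ false u∈r u∈w)))
  force⁺ w v (inj₂ (v∉o , forced)) =
    lookup⇒[]= v _ (trans (lookup-force w v)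
      (trans (cong (if_then _ else _) (¬-not (v∉o ∘ lookup⇒[]= v o))) (cong not missed)))
    where
    missed : misses false (lookup M v) w ≡ false
    missed = ¬-not λ h → case-hit (hits⁻ false (lookup M v) (∁ w)
                                    (trans (sym (misses≡hits-∁ false (lookup M v) w)) h))
      where
      case-hit : ¬ (false ≡ true ⊎ ∃[ u ] E v u × u ∈ ∁ w)
      case-hit (inj₂ (u , u∈r , u∈∁w)) = x∈∁p⇒x∉p u∈∁w (forced u u∈r)

  -- The machine's loop peels off the first enlargement, whereas arguments about layers peel off the
  -- last.
  enlargeBy-enlarge : ∀ i w → enlargeBy o M i (enlarge o M w) ≡ enlarge o M (enlargeBy o M i w)
  enlargeBy-enlarge zero    w = refl
  enlargeBy-enlarge (suc i) w = enlargeBy-enlarge i (enlarge o M w)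

  A : V → ℕ → Subset n
  A t i = enlargeBy o M i ⁅ t ⁆

  Attr : V → Subset n
  Attr t = attractor o M ⁅ t ⁆

  A-suc : ∀ t i → A t (suc i) ≡ enlarge o M (A t i)
  A-suc t i = enlargeBy-enlarge i ⁅ t ⁆

  A-suc⁻ : ∀ t i {v} → v ∈ A t (suc i) → v ∈ A t i ⊎ Forced (A t i) v
  A-suc⁻ t i {v} v∈ with x∈p∪q⁻ (A t i) _ (subst (v ∈_) (A-suc t i) v∈)
  ... | inj₁ v∈A = inj₁ v∈A
  ... | inj₂ v∈f = inj₂ (force⁻ (A t i) v v∈f)

  A-mono-suc : ∀ t i → A t i ⊆ A t (suc i)
  A-mono-suc t i {v} v∈ = subst (v ∈_) (sym (A-suc t i)) (p⊆p∪q _ v∈)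

  A-mono : ∀ t {i j} → i ≤ j → A t i ⊆ A t j
  A-mono t {j = zero}  z≤n v∈ = v∈
  A-mono t {j = suc j} i≤j v∈ with m≤n⇒m<n∨m≡n i≤j
  ... | inj₁ i<j  = A-mono-suc t j (A-mono t (≤-pred i<j) v∈)
  ... | inj₂ refl = v∈

  t∈A : ∀ t i → t ∈ A t i
  t∈A t i = A-mono t (z≤n {i}) (x∈⁅x⁆ t)

  Closed : Subset n → Set
  Closed w = enlarge o M w ⊆ w

  enlarge-cases : ∀ w → Closed w ⊎ ∣ w ∣ < ∣ enlarge o M w ∣
  enlarge-cases w with any? (λ v → (v ∈? enlarge o M w) ×-dec ¬? (v ∈? w))
  ... | yes (v , v∈ , v∉) = inj₂ (p⊂q⇒∣p∣<∣q∣ (p⊆p∪q _ , v , v∈ , v∉))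
  ... | no  none          = inj₁ λ {v} v∈ → closed v v∈
    where
    closed : ∀ v → v ∈ enlarge o M w → v ∈ w
    closed v v∈ with v ∈? w
    ... | yes v∈w = v∈w
    ... | no  v∉w = contradiction (v , v∈ , v∉w) none

  Closed⇒enlarge≡ : ∀ w → Closed w → enlarge o M w ≡ w
  Closed⇒enlarge≡ w closed = ⊆-antisym closed (p⊆p∪q _)

  -- Until the layers become stationary, each round adds a vertex. At i = n another addition would
  -- exceed the number of vertices, which gives `Attr-closed`.
  A-grows : ∀ t i → Closed (A t i) ⊎ i ≤ ∣ A t i ∣
  A-grows t zero    = inj₂ z≤n
  A-grows t (suc i) with enlarge-cases (A t i) | A-grows t i
  ... | inj₁ closed | _           = inj₁ (subst Closed (sym A≡) closed)
    where A≡ = trans (A-suc t i) (Closed⇒enlarge≡ (A t i) closed)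
  ... | inj₂ _      | inj₁ closed = inj₁ (subst Closed (sym A≡) closed)
    where A≡ = trans (A-suc t i) (Closed⇒enlarge≡ (A t i) closed)
  ... | inj₂ grows  | inj₂ i≤     =
    inj₂ (subst (λ w → suc i ≤ ∣ w ∣) (sym (A-suc t i)) (≤-trans (s≤s i≤) grows))

  Attr-closed : ∀ t → Closed (Attr t)
  Attr-closed t with enlarge-cases (A t n) | A-grows t n
  ... | inj₁ closed | _           = closed
  ... | _           | inj₁ closed = closed
  ... | inj₂ grows  | inj₂ n≤     =
    contradiction (≤-trans (s≤s n≤) (≤-trans grows (∣p∣≤n (enlarge o M (A t n))))) 1+n≰n

  Attr-forced : ∀ t {v} → Forced (Attr t) v → v ∈ Attr t
  Attr-forced t {v} f = Attr-closed t (q⊆p∪q (Attr t) _ (force⁺ (Attr t) v f))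

  t∈Attr : ∀ t → t ∈ Attr t
  t∈Attr t = t∈A t n

  -- `Attr t` is closed and contains `s`, and the layers of `s` never leave a closed set that
  -- contains `s`.
  A⊆Attr-trans : ∀ {s t} i → s ∈ Attr t → A s i ⊆ Attr t
  A⊆Attr-trans {s} {t} zero    s∈ {v} v∈ with refl ← x∈⁅y⁆⇒x≡y s v∈ = s∈
  A⊆Attr-trans {s} {t} (suc i) s∈ v∈ with A-suc⁻ s i v∈
  ... | inj₁ v∈A = A⊆Attr-trans i s∈ v∈A
  ... | inj₂ (inj₁ (v∈o , u , e , u∈)) =
    Attr-forced t (inj₁ (v∈o , u , e , A⊆Attr-trans i s∈ u∈))
  ... | inj₂ (inj₂ (v∉o , forced)) =
    Attr-forced t (inj₂ (v∉o , λ u e → A⊆Attr-trans i s∈ (forced u e)))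

  Attr-trans : ∀ {s t v} → v ∈ Attr s → s ∈ Attr t → v ∈ Attr t
  Attr-trans v∈ s∈ = A⊆Attr-trans n s∈ v∈

-- Strategies of Eve and Adam

module Strategies (𝒜 : Arena) where
  open Arena 𝒜
  open Attractors V∘ successors hiding (E)

  -- A successor of v that enters the layers A t 0 ⊆ … ⊆ A t m as early as possible.
  approach : V → ℕ → (v : V) → ∃[ u ] E v u
  approach t zero    v = no-dead-end v
  approach t (suc m) v with proj₁ (approach t m v) ∈? A t m
                          | any? (λ u → (u ∈? lookup successors v) ×-dec (u ∈? A t m))
  ... | no _ | yes (u , e , _) = u , e
  ... | _    | _               = approach t m v

  -- The choice for `m` is replaced at `suc m` only if it misses `A t m`; one that lies in an
  -- earlier layer lies in `A t m` as well and is kept.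
  approach-enters : ∀ t m {j v} → j < m → (∃[ u ] E v u × u ∈ A t j) →
                    proj₁ (approach t m v) ∈ A t j
  approach-enters t (suc m) {j} {v} (s≤s j≤m) ex
    with proj₁ (approach t m v) ∈? A t m
       | any? (λ u → (u ∈? lookup successors v) ×-dec (u ∈? A t m)) | m≤n⇒m<n∨m≡n j≤m
  ... | no _  | yes (u , e , u∈) | inj₂ refl = u∈
  ... | no ∉  | yes _            | inj₁ j<m  =
    contradiction (A-mono t j≤m (approach-enters t m j<m ex)) ∉
  ... | yes _ | yes _            | inj₁ j<m  = approach-enters t m j<m ex
  ... | yes ∈ | yes _            | inj₂ refl = ∈
  ... | yes _ | no _             | inj₁ j<m  = approach-enters t m j<m ex
  ... | yes ∈ | no _             | inj₂ refl = ∈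
  ... | no _  | no ∄             | _         =
    contradiction (proj₁ ex , proj₁ (proj₂ ex) , A-mono t j≤m (proj₂ (proj₂ ex))) ∄

  evade : V → (v : V) → ∃[ u ] E v u
  evade t v with any? (λ u → (u ∈? lookup successors v) ×-dec ¬? (u ∈? Attr t))
  ... | yes (u , e , _) = u , e
  ... | no _            = no-dead-end v

  -- Otherwise all successors would lie in `Attr t`, and closedness would put `v` there too.
  evade-escapes : ∀ t {v} → v ∉ V∘ → v ∉ Attr t → proj₁ (evade t v) ∉ Attr t
  evade-escapes t {v} v∉V∘ v∉ with any? (λ u → (u ∈? lookup successors v) ×-dec ¬? (u ∈? Attr t))
  ... | yes (_ , _ , u∉) = u∉
  ... | no ∄             = contradiction (Attr-forced t (inj₂ (v∉V∘ , forced))) v∉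
    where
    forced : ∀ u → E v u → u ∈ Attr t
    forced u e with u ∈? Attr t
    ... | yes u∈ = u∈
    ... | no  u∉ = contradiction (u , e , u∉) ∄

  module _ {v₀ : V} {σ : EveStrategy 𝒜} {τ : AdamStrategy 𝒜} (w : List V) (v : V) where

    -- The membership proof is existential because `move` hands over the one found by its own test.
    move-Eve : v ∈ V∘ → ∃[ v∈ ] proj₁ (move v₀ σ τ w v) ≡ Strategy.next σ w v v∈
    move-Eve v∈V∘ with v ∈? V∘
    ... | yes v∈  = v∈ , refl
    ... | no v∉V∘ = contradiction v∈V∘ v∉V∘

    move-Adam : v ∉ V∘ → ∃[ v∈ ] proj₁ (move v₀ σ τ w v) ≡ Strategy.next τ w v v∈
    move-Adam v∉V∘ with v ∈? V∘
    ... | yes v∈V∘ = contradiction v∈V∘ v∉V∘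
    ... | no _     = _ , refl

  remove : V → List V → List V
  remove v = filter (λ u → ¬? (v ≟ u))

  preferred : List V → Maybe V
  preferred []      = nothing
  preferred (x ∷ l) with preferred l
  ... | nothing = just x
  ... | just y with x ∈? Attr y
  ...   | yes _ = just x
  ...   | no _  = just y

  Comparable : V → V → Set
  Comparable x y = x ∈ Attr y ⊎ y ∈ Attr x

  preferred-nothing : ∀ l → preferred l ≡ nothing → l ≡ []
  preferred-nothing []      _ = refl
  preferred-nothing (x ∷ l) p with preferred l
  ... | just y with x ∈? Attr y
  preferred-nothing (x ∷ l) () | just y | yes _
  preferred-nothing (x ∷ l) () | just y | no _

  -- Let y be least in the tail. Either the head precedes y, hence everything by transitivity, or
  -- totality makes y precede the head.
  preferred-just : ∀ l {t} → (∀ {x y} → x ∈ₗ l → y ∈ₗ l → Comparable x y) →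
                   preferred l ≡ just t → t ∈ₗ l × (∀ {u} → u ∈ₗ l → t ∈ Attr u)
  preferred-just (x ∷ l) total p with preferred l in l≡
  preferred-just (x ∷ l) total refl | nothing rewrite preferred-nothing l l≡ =
    Any.here refl , λ { (Any.here refl) → t∈Attr x }
  ... | just y with preferred-just l (λ x∈ y∈ → total (Any.there x∈) (Any.there y∈)) l≡
                  | x ∈? Attr y
  preferred-just (x ∷ l) total refl | just y | y∈ , y-least | yes x∈ =
    Any.here refl , λ { (Any.here refl) → t∈Attr x ; (Any.there u∈) → Attr-trans x∈ (y-least u∈) }
  preferred-just (x ∷ l) total refl | just y | y∈ , y-least | no x∉ =
    Any.there y∈ , λ { (Any.here refl) → y∈Attr-x ; (Any.there u∈) → y-least u∈ }
    where
    y∈Attr-x : y ∈ Attr x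
    y∈Attr-x with total (Any.here refl) (Any.there y∈)
    ... | inj₁ x∈ = contradiction x∈ x∉
    ... | inj₂ y∈ = y∈

  module Eve (ts : List V) (total : ∀ {x y} → x ∈ₗ ts → y ∈ₗ ts → Comparable x y) where

    -- A left fold, because histories grow at their right end: a new vertex then acts on the earlier
    -- result.
    unvisited : List V → List V
    unvisited = foldl (λ us v → remove v us) ts

    choose : Maybe V → (v : V) → ∃[ u ] E v u
    choose (just t) v = approach t ∣V∣ v
    choose nothing  v = no-dead-end v

    σ : EveStrategy 𝒜
    σ = record
      { next  = λ w v _ → proj₁ (choose (preferred (unvisited (w ∷ʳ v))) v)
      ; legal = λ w v _ → proj₂ (choose (preferred (unvisited (w ∷ʳ v))) v)
      }

    module _ (v₀ : V) (reach : ∀ {t} → t ∈ₗ ts → v₀ ∈ Attr t) (τ : AdamStrategy 𝒜) where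

      cur : ℕ → V
      cur = current v₀ σ τ

      -- The past of `suc i` is used so that the vertex at time i already counts as visited.
      unv : ℕ → List V
      unv i = unvisited (past v₀ σ τ (suc i))

      unv-suc : ∀ i → unv (suc i) ≡ remove (cur (suc i)) (unv i)
      unv-suc i = foldl-∷ʳ _ ts (cur (suc i)) (past v₀ σ τ (suc i))

      unv-suc⁻ : ∀ i {u} → u ∈ₗ unv (suc i) → u ∈ₗ unv i
      unv-suc⁻ i u∈ = proj₁ (∈-filter⁻ _ (subst (_ ∈ₗ_) (unv-suc i) u∈))

      unv⊆ts : ∀ i {u} → u ∈ₗ unv i → u ∈ₗ ts
      unv⊆ts zero    u∈ = proj₁ (∈-filter⁻ _ u∈)
      unv⊆ts (suc i) u∈ = unv⊆ts i (unv-suc⁻ i u∈)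

      cur∉unv : ∀ i {u} → u ∈ₗ unv i → cur i ≢ u
      cur∉unv zero    u∈ = proj₂ (∈-filter⁻ _ {xs = ts} u∈)
      cur∉unv (suc i) u∈ = proj₂ (∈-filter⁻ _ {xs = unv i} (subst (_ ∈ₗ_) (unv-suc i) u∈))

      visited : ∀ i {t} → t ∈ₗ ts → t ∈ₗ unv i ⊎ ∃[ p ] cur p ≡ t
      visited zero    {t} t∈ with v₀ ≟ t
      ... | yes v₀≡t = inj₂ (0 , v₀≡t)
      ... | no  v₀≢t = inj₁ (∈-filter⁺ _ t∈ v₀≢t)
      visited (suc i) {t} t∈ with visited i t∈ | cur (suc i) ≟ t
      ... | inj₂ p   | _        = inj₂ p
      ... | inj₁ _   | yes c≡t  = inj₂ (suc i , c≡t)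
      ... | inj₁ t∈u | no  c≢t  = inj₁ (subst (t ∈ₗ_) (sym (unv-suc i)) (∈-filter⁺ _ t∈u c≢t))

      -- A vertex in layer m + 1 is either forced into layer m, by `approach` if Eve moves and by
      -- every edge if Adam does, or lies in layer m already. The latter is settled by recursion,
      -- ending at layer 0, which is {t}.
      advance : ∀ i {t} m → preferred (unv i) ≡ just t → cur i ≢ t → suc m ≤ ∣V∣ →
                cur i ∈ A t (suc m) → cur (suc i) ∈ A t m
      advance i {t} m pref c≢t m<n c∈ with A-suc⁻ t m c∈
      advance i {t} zero    pref c≢t m<n c∈ | inj₁ c∈A = contradiction (x∈⁅y⁆⇒x≡y t c∈A) c≢t
      advance i {t} (suc m) pref c≢t m<n c∈ | inj₁ c∈A =
        A-mono-suc t m (advance i m pref c≢t (<⇒≤ m<n) c∈A)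
      advance i {t} m pref c≢t m<n c∈ | inj₂ (inj₁ (c∈V∘ , ex)) =
        subst (_∈ A t m)
          (sym (trans (proj₂ (move-Eve {v₀} {σ} {τ} (past v₀ σ τ i) (cur i) c∈V∘))
                      (cong (λ p → proj₁ (choose p (cur i))) pref)))
          (approach-enters t ∣V∣ m<n ex)
      advance i {t} m pref c≢t m<n c∈ | inj₂ (inj₂ (_ , forced)) =
        forced (cur (suc i)) (Play.edge (π v₀ σ τ) i)

      -- Lexicographic induction: `c` bounds the number of unvisited targets and `m` is a layer of
      -- the preferred one. A move that visits no target lowers `m`; a move that visits one lowers
      -- `c` and resets `m`. The last hypothesis is the invariant that every unvisited target can
      -- still be forced.
      exhausts : ∀ c m i → length (unv i) ≤ c → m ≤ ∣V∣ →
                 (∀ {t} → preferred (unv i) ≡ just t → cur i ∈ A t m) →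
                 (∀ {u} → u ∈ₗ unv i → cur i ∈ Attr u) → ∃[ j ] unv j ≡ []
      exhausts c m i len m≤n near inv with preferred (unv i) in pref
      ... | nothing = i , preferred-nothing (unv i) pref
      ... | just t with preferred-just (unv i) (λ x∈ y∈ → total (unv⊆ts i x∈) (unv⊆ts i y∈)) pref
      exhausts c zero i len m≤n near inv | just t | t∈ , _ =
        contradiction (x∈⁅y⁆⇒x≡y t (near refl)) (cur∉unv i t∈)
      exhausts c (suc m) i len m≤n near inv | just t | t∈ , t-least = continue c len
        where
        c∈A : cur (suc i) ∈ A t m
        c∈A = advance i m pref (cur∉unv i t∈) m≤n (near refl)
        inv′ : ∀ {u} → u ∈ₗ unv (suc i) → cur (suc i) ∈ Attr u
        inv′ u∈ = Attr-trans (A-mono t (<⇒≤ m≤n) c∈A) (t-least (unv-suc⁻ i u∈))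
        continue : ∀ c → length (unv i) ≤ c → ∃[ j ] unv j ≡ []
        continue c len with ∈ₗ? _≟_ (cur (suc i)) (unv i)
        -- No target was visited, so `t` is still the preferred one and the smaller layer counts.
        ... | no ∉ = exhausts c m (suc i) (subst (λ l → length l ≤ c) (sym unv≡) len) (<⇒≤ m≤n)
                       (λ p → subst (λ t → cur (suc i) ∈ A t m)
                                (just-injective (trans (sym pref) (trans (sym (cong preferred unv≡)) p)))
                                c∈A)
                       inv′
          where
          unv≡ : unv (suc i) ≡ unv i
          unv≡ = trans (unv-suc i) (filter-all _ (ListAll.tabulate λ u∈ c≡u → ∉ (subst (_∈ₗ unv i) (sym c≡u) u∈)))
        continue zero len | yes ∈ = contradiction (≤-trans (nonempty ∈) len) λ ()
          where
          nonempty : ∀ {x : V} {l} → x ∈ₗ l → 1 ≤ length l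
          nonempty (Any.here _)  = s≤s z≤n
          nonempty (Any.there _) = s≤s z≤n
        -- The visited target need not be `t`, and another may be preferred now. The layer restarts
        -- at `∣V∣`, where it is the whole attractor and the invariant applies.
        continue (suc c) len | yes ∈ =
          exhausts c ∣V∣ (suc i) (≤-pred (≤-trans shorter len)) ≤-refl
            (λ p → inv′ (proj₁ (preferred-just (unv (suc i))
              (λ x∈ y∈ → total (unv⊆ts (suc i) x∈) (unv⊆ts (suc i) y∈)) p)))
            inv′
          where
          shorter : length (unv (suc i)) < length (unv i)
          shorter rewrite unv-suc i =
            filter-notAll _ (unv i) (Any.map (λ c≡u c≢u → c≢u c≡u) ∈)

      reaches-all : ∀ {t} → t ∈ₗ ts → ∃[ p ] cur p ≡ t
      reaches-all t∈ with exhausts (length (unv 0)) ∣V∣ 0 ≤-refl ≤-refl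
                            (λ p → reach (unv⊆ts 0 (proj₁ (preferred-just (unv 0)
                              (λ x∈ y∈ → total (unv⊆ts 0 x∈) (unv⊆ts 0 y∈)) p))))
                            (λ u∈ → reach (unv⊆ts 0 u∈))
      ... | j , unv≡[] with visited j t∈
      ...   | inj₂ p  = p
      ...   | inj₁ t∈unv with () ← subst (_ ∈ₗ_) unv≡[] t∈unv

  -- Common to both necessity proofs: `mode` reads off the history which attractor Adam avoids, with
  -- `nothing` while he waits.
  module Adam (v₀ : V) (σ : EveStrategy 𝒜) (mode : List V → Maybe V) where

    respond : Maybe V → (v : V) → ∃[ u ] E v u
    respond (just t) v = evade t v
    respond nothing  v = no-dead-end v

    τ : AdamStrategy 𝒜
    τ = record
      { next  = λ w v _ → proj₁ (respond (mode (w ∷ʳ v)) v)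
      ; legal = λ w v _ → proj₂ (respond (mode (w ∷ʳ v)) v)
      }

    cur : ℕ → V
    cur = current v₀ σ τ

    hist : ℕ → List V
    hist = past v₀ σ τ

    -- A vertex of Eve outside the closed set `Attr t` has no edge into it, and a vertex of Adam
    -- outside has an edge that avoids it.
    stays-out : ∀ i {t} → mode (hist (suc i)) ≡ just t → cur i ∉ Attr t → cur (suc i) ∉ Attr t
    stays-out i {t} mode≡ c∉ = by-owner (cur i ∈? V∘)
      where
      by-owner : Dec (cur i ∈ V∘) → cur (suc i) ∉ Attr t
      by-owner (yes c∈V∘) c′∈ =
        c∉ (Attr-forced t (inj₁ (c∈V∘ , cur (suc i) , Play.edge (π v₀ σ τ) i , c′∈)))
      by-owner (no c∉V∘) = subst (_∉ Attr t)
        (sym (trans (proj₂ (move-Adam {v₀} {σ} {τ} (hist i) (cur i) c∉V∘))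
                    (cong (λ m → proj₁ (respond m (cur i))) mode≡)))
        (evade-escapes t c∉V∘ c∉)

  necessary-start : ∀ v₀ (σ : EveStrategy 𝒜) t →
                    ((τ : AdamStrategy 𝒜) → ∃[ p ] current v₀ σ τ p ≡ t) → v₀ ∈ Attr t
  necessary-start v₀ σ t wins with v₀ ∈? Attr t
  ... | yes v₀∈ = v₀∈
  ... | no  v₀∉ = let p , c≡t = wins τ in
                  contradiction (subst (_∈ Attr t) (sym c≡t) (t∈Attr t)) (out p)
    where
    open Adam v₀ σ (const (just t))
    out : ∀ i → cur i ∉ Attr t
    out zero    = v₀∉
    out (suc i) = stays-out i refl (out i)

  necessary-comparable : ∀ v₀ (σ : EveStrategy 𝒜) s t →
    ((τ : AdamStrategy 𝒜) → ∃[ p ] current v₀ σ τ p ≡ s) →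
    ((τ : AdamStrategy 𝒜) → ∃[ p ] current v₀ σ τ p ≡ t) → Comparable s t
  necessary-comparable v₀ σ s t wins-s wins-t with s ∈? Attr t | t ∈? Attr s
  ... | yes s∈ | _      = inj₁ s∈
  ... | no _   | yes t∈ = inj₂ t∈
  -- Both hypotheses are applied to the same `τ`, so p and q are times of one play, and both precede
  -- `suc (p ⊔ q)`.
  ... | no s∉  | no t∉  = ⊥-elim (separated (invariant (suc (p ⊔ q))))
    where
    s≢t : s ≢ t
    s≢t refl = s∉ (t∈Attr s)

    remember : Maybe V → V → Maybe V
    remember (just u) v = just u
    remember nothing  v with v ≟ s | v ≟ t
    ... | yes _ | _     = just t
    ... | no _  | yes _ = just s
    ... | no _  | no _  = nothing

    open Adam v₀ σ (foldl remember nothing)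

    p = proj₁ (wins-s τ)
    q = proj₁ (wins-t τ)

    Avoided : V → ℕ → Set
    Avoided u i = ∀ j → j < i → cur j ≢ u

    extend : ∀ {u i} → Avoided u i → cur i ≢ u → Avoided u (suc i)
    extend av c≢u j (s≤s j≤i) with m≤n⇒m<n∨m≡n j≤i
    ... | inj₁ j<i  = av j j<i
    ... | inj₂ refl = c≢u

    Banned : V → ℕ → Set
    Banned u i = foldl remember nothing (hist i) ≡ just u × cur i ∉ Attr u × Avoided u i

    -- In each of the three cases at least one of the two targets has not been visited before time
    -- i.
    Invariant : ℕ → Set
    Invariant i = (foldl remember nothing (hist i) ≡ nothing × Avoided s i × Avoided t i) ⊎
                  Banned t i ⊎ Banned s i

    mode-suc : ∀ i {m} → foldl remember nothing (hist i) ≡ m →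
               foldl remember nothing (hist (suc i)) ≡ remember m (cur i)
    mode-suc i mode≡ = trans (foldl-∷ʳ remember nothing (cur i) (hist i))
                             (cong (λ m → remember m (cur i)) mode≡)

    -- The mode already takes the vertex at time i into account, so Adam evades on the very move
    -- that leaves the vertex triggering the ban.
    ban : ∀ i {u} → foldl remember nothing (hist (suc i)) ≡ just u → cur i ∉ Attr u →
          Avoided u i → Banned u (suc i)
    ban i {u} mode≡ c∉ av =
      mode≡ , stays-out i mode≡ c∉ ,
      extend av λ c≡u → c∉ (subst (_∈ Attr u) (sym c≡u) (t∈Attr u))

    invariant : ∀ i → Invariant i
    invariant zero    = inj₁ (refl , (λ _ ()) , (λ _ ()))
    invariant (suc i) with invariant i
    ... | inj₂ (inj₁ (mode≡ , c∉ , av)) = inj₂ (inj₁ (ban i (mode-suc i mode≡) c∉ av))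
    ... | inj₂ (inj₂ (mode≡ , c∉ , av)) = inj₂ (inj₂ (ban i (mode-suc i mode≡) c∉ av))
    ... | inj₁ (mode≡ , av-s , av-t) with cur i ≟ s | cur i ≟ t | mode-suc i mode≡
    ...   | yes c≡s | _       | mode≡′ = inj₂ (inj₁ (ban i mode≡′ (subst (_∉ Attr t) (sym c≡s) s∉) av-t))
    ...   | no _    | yes c≡t | mode≡′ = inj₂ (inj₂ (ban i mode≡′ (subst (_∉ Attr s) (sym c≡t) t∉) av-s))
    ...   | no c≢s  | no c≢t  | mode≡′ = inj₁ (mode≡′ , extend av-s c≢s , extend av-t c≢t)

    separated : ¬ Invariant (suc (p ⊔ q))
    separated (inj₁ (_ , av-s , _))        = av-s p (s≤s (m≤m⊔n p q)) (proj₂ (wins-s τ))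
    separated (inj₂ (inj₁ (_ , _ , av-t))) = av-t q (s≤s (m≤n⊔m p q)) (proj₂ (wins-t τ))
    separated (inj₂ (inj₂ (_ , _ , av-s))) = av-s p (s≤s (m≤m⊔n p q)) (proj₂ (wins-s τ))

-- Correctness of the decision procedure

-- `encode` for loose data: during parsing it is not yet known that no matrix row is empty or that
-- `s` is a singleton.
word : ∀ {n k} → Subset n → Vec (Subset n) n → Vec (Subset n) k → Subset n → Word
word {n} {k} o M F s = unary n ++ unary k ++ toList o ++ rows M ++ rows F ++ toList s

∨-false : ∀ a {b} → a ∨ b ≡ false → a ≡ false × b ≡ false
∨-false false b≡f = refl , b≡f

leading-unary : ∀ n w → leading (unary n ++ w) ≡ n
leading-unary zero    w = refl
leading-unary (suc n) w = cong suc (leading-unary n w)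

afterUnary-unary : ∀ n w → afterUnary (unary n ++ w) ≡ w
afterUnary-unary zero    w = refl
afterUnary-unary (suc n) w = afterUnary-unary n w

unterminated-unary : ∀ n w → unterminated (unary n ++ w) ≡ false
unterminated-unary zero    w = refl
unterminated-unary (suc n) w = unterminated-unary n w

terminated : ∀ w → unterminated w ≡ false → w ≡ unary (leading w) ++ afterUnary w
terminated (false ∷ w) _ = refl
terminated (true ∷ w)  t = cong (true ∷_) (terminated w t)

beyond : ∀ {n} → List Sym → Vec Bool n → List Sym
beyond ls []      = ls
beyond ls (x ∷ v) = beyond (bit x ∷ ls) v

beyondRows : ∀ {m n} → List Sym → Vec (Vec Bool n) m → List Sym
beyondRows ls []      = ls
beyondRows ls (r ∷ M) = beyondRows (beyond ls r) M

bitsOf-Y : ∀ {n} (v : Vec Bool n) ls w → bitsOf n (Y ls (toList v ++ w)) ≡ v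
bitsOf-Y []      ls w = refl
bitsOf-Y (x ∷ v) ls w rewrite Y-right ls x (toList v ++ w) =
  cong (x ∷_) (bitsOf-Y v (bit x ∷ ls) w)

skip-Y : ∀ {n} (v : Vec Bool n) ls w → skip n (Y ls (toList v ++ w)) ≡ Y (beyond ls v) w
skip-Y []      ls w = refl
skip-Y (x ∷ v) ls w rewrite Y-right ls x (toList v ++ w) = skip-Y v (bit x ∷ ls) w

short-Y : ∀ {n} (v : Vec Bool n) ls w r → short n (Y ls (toList v ++ w)) r ≡ r
short-Y []      ls w r = refl
short-Y (x ∷ v) ls w r rewrite Y-right ls x (toList v ++ w) | ∨-identityʳ r =
  short-Y v (bit x ∷ ls) w r

rowsOf-Y : ∀ {m n} (M : Vec (Vec Bool n) m) ls w → rowsOf m n (Y ls (rows M ++ w)) ≡ M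
rowsOf-Y []      ls w = refl
rowsOf-Y (r ∷ M) ls w
  rewrite ++-assoc (toList r) (rows M) w
        | bitsOf-Y r ls (rows M ++ w) | skip-Y r ls (rows M ++ w) =
  cong (r ∷_) (rowsOf-Y M (beyond ls r) w)

skipRows-Y : ∀ {m n} (M : Vec (Vec Bool n) m) ls w →
             skipRows m n (Y ls (rows M ++ w)) ≡ Y (beyondRows ls M) w
skipRows-Y []      ls w = refl
skipRows-Y (r ∷ M) ls w
  rewrite ++-assoc (toList r) (rows M) w | skip-Y r ls (rows M ++ w) =
  skipRows-Y M (beyond ls r) w

rowDefect : ∀ {n} → Defect → Vec Bool n → Bool → Bool
rowDefect bad v r = r ∨ bad (some false v) (many false false v)

rowsDefect : ∀ {m n} → Defect → Vec (Vec Bool n) m → Bool → Bool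
rowsDefect bad []      r = r
rowsDefect bad (v ∷ M) r = rowsDefect bad M (rowDefect bad v r)

rowFlag-Y : ∀ bad {n} (v : Vec Bool n) ls w r →
            rowFlag bad n (Y ls (toList v ++ w)) r ≡ rowDefect bad v r
rowFlag-Y bad v ls w r rewrite short-Y v ls w r | bitsOf-Y v ls w = refl

rowsFlag-Y : ∀ bad {m n} (M : Vec (Vec Bool n) m) ls w r →
             rowsFlag bad m n (Y ls (rows M ++ w)) r ≡ rowsDefect bad M r
rowsFlag-Y bad []      ls w r = refl
rowsFlag-Y bad (v ∷ M) ls w r
  rewrite ++-assoc (toList v) (rows M) w
        | rowFlag-Y bad v ls (rows M ++ w) r | skip-Y v ls (rows M ++ w) =
  rowsFlag-Y bad M (beyond ls v) w (rowDefect bad v r)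

defects : ∀ {n k} → Subset n → Vec (Subset n) n → Vec (Subset n) k → Bool
defects o M F = rowsDefect notSingleton F (rowsDefect empty M (rowDefect arbitrary o false))

verdict : ∀ {n k} → Subset n → Vec (Subset n) n → Vec (Subset n) k → Subset n → Bool
verdict o M F s =
  conflicts o M s F F (rowDefect notSingleton s (defects o M F))

rejects-Y : ∀ {n k} (o : Subset n) (M : Vec (Subset n) n) (F : Vec (Subset n) k) (s : Subset n) ls →
            Matrices.rejects n k (Y ls (toList o ++ rows M ++ rows F ++ toList s ++ [])) false ≡
            verdict o M F s
rejects-Y o M F s ls
  rewrite rowFlag-Y arbitrary o ls (rows M ++ rows F ++ toList s ++ []) false
        | bitsOf-Y o ls (rows M ++ rows F ++ toList s ++ [])
        | skip-Y o ls (rows M ++ rows F ++ toList s ++ [])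
        | rowsFlag-Y empty M (beyond ls o) (rows F ++ toList s ++ []) (rowDefect arbitrary o false)
        | rowsOf-Y M (beyond ls o) (rows F ++ toList s ++ [])
        | skipRows-Y M (beyond ls o) (rows F ++ toList s ++ [])
        | rowsFlag-Y notSingleton F (beyondRows (beyond ls o) M) (toList s ++ [])
            (rowsDefect empty M (rowDefect arbitrary o false))
        | rowsOf-Y F (beyondRows (beyond ls o) M) (toList s ++ [])
        | skipRows-Y F (beyondRows (beyond ls o) M) (toList s ++ [])
        | rowFlag-Y notSingleton s (beyondRows (beyondRows (beyond ls o) M) F) []
            (rowsDefect notSingleton F (rowsDefect empty M (rowDefect arbitrary o false)))
        | bitsOf-Y s (beyondRows (beyondRows (beyond ls o) M) F) []
        | skip-Y s (beyondRows (beyondRows (beyond ls o) M) F) []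
        | ∨-identityʳ (rowDefect notSingleton s
            (rowsDefect notSingleton F (rowsDefect empty M (rowDefect arbitrary o false)))) = refl

rejectsWord-word : ∀ {n k} (o : Subset n) (M : Vec (Subset n) n) (F : Vec (Subset n) k) s →
                   rejectsWord (word o M F s) ≡ verdict o M F s
rejectsWord-word {n} {k} o M F s
  rewrite leading-unary n (unary k ++ toList o ++ rows M ++ rows F ++ toList s)
        | afterUnary-unary n (unary k ++ toList o ++ rows M ++ rows F ++ toList s)
        | unterminated-unary n (unary k ++ toList o ++ rows M ++ rows F ++ toList s)
        | leading-unary k (toList o ++ rows M ++ rows F ++ toList s)
        | afterUnary-unary k (toList o ++ rows M ++ rows F ++ toList s)
        | unterminated-unary k (toList o ++ rows M ++ rows F ++ toList s)
        | sym (++-identityʳ (toList s)) = rejects-Y o M F s _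

-- The reject flag only rises. A final `false` therefore holds at every earlier stage too, which is
-- how the parse is recovered from the outcome.
short-initial : ∀ n t r → short n t r ≡ false → r ≡ false
short-initial zero    t r h = h
short-initial (suc n) t r h = proj₁ (∨-false r (short-initial n (shift right t) _ h))

rowFlag-initial : ∀ bad n t r → rowFlag bad n t r ≡ false → r ≡ false
rowFlag-initial bad n t r h = short-initial n t r (proj₁ (∨-false (short n t r) h))

rowsFlag-initial : ∀ bad m n t r → rowsFlag bad m n t r ≡ false → r ≡ false
rowsFlag-initial bad zero    n t r h = h
rowsFlag-initial bad (suc m) n t r h =
  rowFlag-initial bad n t r (rowsFlag-initial bad m n (skip n t) (rowFlag bad n t r) h)

short-sound : ∀ n ls w r → short n (Y ls w) r ≡ false →
              ∃[ v ] ∃[ w′ ] w ≡ toList {n = n} v ++ w′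
short-sound zero    ls w       r h = [] , w , refl
short-sound (suc n) ls []      r h =
  contradiction (trans (sym (∨-zeroʳ r)) (short-initial n (Y (blank ∷ ls) []) (r ∨ true) h)) λ ()
short-sound (suc n) ls (x ∷ w) r h rewrite Y-right ls x w =
  let v , w′ , w≡ = short-sound n (bit x ∷ ls) w (r ∨ false) h
  in x ∷ v , w′ , cong (x ∷_) w≡

rowFlag-sound : ∀ bad n ls w r → rowFlag bad n (Y ls w) r ≡ false →
                ∃[ v ] ∃[ w′ ] w ≡ toList {n = n} v ++ w′
rowFlag-sound bad n ls w r h = short-sound n ls w r (proj₁ (∨-false (short n (Y ls w) r) h))

rowsFlag-sound : ∀ bad m n ls w r → rowsFlag bad m n (Y ls w) r ≡ false →
                 ∃[ M ] ∃[ w′ ] w ≡ rows {m} {n} M ++ w′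
rowsFlag-sound bad zero    n ls w r h = [] , w , refl
rowsFlag-sound bad (suc m) n ls w r h
  with rowFlag-sound bad n ls w r
         (rowsFlag-initial bad m n (skip n (Y ls w)) (rowFlag bad n (Y ls w) r) h)
... | v , w₁ , refl
  with r′ ← rowFlag bad n (Y ls (toList v ++ w₁)) r
  with rowsFlag-sound bad m n (beyond ls v) w₁ r′
         (subst (λ t → rowsFlag bad m n t r′ ≡ false) (skip-Y v ls w₁) h)
... | M , w₂ , refl = v ∷ M , w₂ , sym (++-assoc (toList v) (rows M) w₂)

clashes-initial : ∀ {n k} o M (s p : Subset n) (G : Vec (Subset n) k) r →
                  clashes o M s p G r ≡ false → r ≡ false
clashes-initial o M s p []      r h = h
clashes-initial o M s p (g ∷ G) r h = proj₁ (∨-false r (clashes-initial o M s p G _ h))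

conflicts-initial : ∀ {n i k} o M (s : Subset n) (F : Vec (Subset n) i) (G : Vec (Subset n) k) r →
                    conflicts o M s F G r ≡ false → r ≡ false
conflicts-initial o M s []      G r h = h
conflicts-initial o M s (f ∷ F) G r h =
  clashes-initial o M s f G r (conflicts-initial o M s F G _ h)

unread : ∀ w → isBit (hd w) ≡ false → w ≡ []
unread [] _ = refl

-- Each stage with an unset flag splits one block off the word, and the equations for the tapes
-- carry the next flag over to what remains. Only the shape of the word is extracted; that the
-- machine works with these blocks is `rejectsWord-word`.
Matrices-sound : ∀ n k ls w r → Matrices.rejects n k (Y ls w) r ≡ false →
  r ≡ false × ∃[ o ] ∃[ M ] ∃[ F ] ∃[ s ]
    w ≡ toList {n = n} o ++ rows {n} {n} M ++ rows {k} {n} F ++ toList {n = n} s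
Matrices-sound n k ls w r h = parsed
  where
  open Matrices n k (Y ls w) r
  r₇-false = conflicts-initial o M s F F r₇ h
  r₆-false = proj₁ (∨-false r₆ r₇-false)
  r₅-false = rowFlag-initial notSingleton n t₅ r₅ r₆-false
  r₄-false = rowsFlag-initial notSingleton k n t₄ r₄ r₅-false
  r₃-false = rowsFlag-initial empty n n t₃ r₃ r₄-false

  parsed : r ≡ false × ∃[ o ] ∃[ M ] ∃[ F ] ∃[ s ]
         w ≡ toList {n = n} o ++ rows {n} {n} M ++ rows {k} {n} F ++ toList {n = n} s
  parsed with rowFlag-sound arbitrary n ls w r r₃-false
  ... | o′ , w₃ , refl
    with t₃≡ ← skip-Y o′ ls w₃
    with rowsFlag-sound empty n n (beyond ls o′) w₃ r₃
           (subst (λ t → rowsFlag empty n n t r₃ ≡ false) t₃≡ r₄-false)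
  ... | M′ , w₄ , refl
    with t₄≡ ← trans (cong (skipRows n n) t₃≡) (skipRows-Y M′ (beyond ls o′) w₄)
    with rowsFlag-sound notSingleton k n _ w₄ r₄
           (subst (λ t → rowsFlag notSingleton k n t r₄ ≡ false) t₄≡ r₅-false)
  ... | F′ , w₅ , refl
    with t₅≡ ← trans (cong (skipRows k n) t₄≡) (skipRows-Y F′ (beyondRows (beyond ls o′) M′) w₅)
    with rowFlag-sound notSingleton n _ w₅ r₅
           (subst (λ t → rowFlag notSingleton n t r₅ ≡ false) t₅≡ r₆-false)
  ... | s′ , w₆ , refl
    with t₆≡ ← trans (cong (skip n) t₅≡) (skip-Y s′ (beyondRows (beyondRows (beyond ls o′) M′) F′) w₆)
    with refl ← unread w₆ (subst (λ t → isBit (Tape.head t) ≡ false) t₆≡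
                              (proj₂ (∨-false r₆ r₇-false))) =
    rowFlag-initial arbitrary n (Y ls w) r r₃-false ,
    o′ , M′ , F′ , s′ , cong (λ v → toList o′ ++ rows M′ ++ rows F′ ++ v) (++-identityʳ (toList s′))

rejectsWord-sound : ∀ w → rejectsWord w ≡ false →
  ∃[ n ] ∃[ k ] ∃[ o ] ∃[ M ] ∃[ F ] ∃[ s ] w ≡ word {n} {k} o M F s
rejectsWord-sound w h =
  let r , o , M , F , s , w₂≡ = Matrices-sound (leading w) (leading (afterUnary w))
                                  (beforeUnary (beforeUnary [] w) (afterUnary w)) _ _ h
      t₁ , t₂ = ∨-false (unterminated w) r
  in _ , _ , o , M , F , s ,
     trans (terminated w t₁) (cong (unary (leading w) ++_)
       (trans (terminated (afterUnary w) t₂) (cong (unary (leading (afterUnary w)) ++_) w₂≡)))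

-- The meaning of the row checks and of the verdict

some-true : ∀ {n} (v : Subset n) → some true v ≡ true
some-true []      = refl
some-true (x ∷ v) = some-true v

some⁺ : ∀ {n} a {v : Subset n} → Nonempty v → some a v ≡ true
some⁺ a {true ∷ v} (zero , here)       rewrite ∨-zeroʳ a = some-true v
some⁺ a {x ∷ v}    (suc u , there u∈v) = some⁺ (a ∨ x) (u , u∈v)

some⁻ : ∀ {n} (v : Subset n) → some false v ≡ true → Nonempty v
some⁻ (true ∷ v)  h = zero , here
some⁻ (false ∷ v) h = let u , u∈v = some⁻ v h in suc u , there u∈v

many-true : ∀ {n} a (v : Subset n) → many a true v ≡ true
many-true a []      = refl
many-true a (x ∷ v) = many-true (a ∨ x) v

many-∅ : ∀ {n} a → many a false (∅ {n}) ≡ false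
many-∅ {zero}  a     = refl
many-∅ {suc n} true  = many-∅ {n} true
many-∅ {suc n} false = many-∅ {n} false

many-true⁻ : ∀ {n} (v : Subset n) → many true false v ≡ false → v ≡ ∅
many-true⁻ []          h = refl
many-true⁻ (true ∷ v)  h = contradiction (trans (sym (many-true true v)) h) λ ()
many-true⁻ (false ∷ v) h = cong (false ∷_) (many-true⁻ v h)

many-⁅⁆ : ∀ {n} (x : Fin n) → many false false ⁅ x ⁆ ≡ false
many-⁅⁆ {suc n} zero    = many-∅ {n} true
many-⁅⁆         (suc x) = many-⁅⁆ x

singleton⁻ : ∀ {n} (v : Subset n) → some false v ≡ true → many false false v ≡ false →
             ∃[ x ] v ≡ ⁅ x ⁆
singleton⁻ (true ∷ v)  s m = zero , cong (true ∷_) (many-true⁻ v m)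
singleton⁻ (false ∷ v) s m = let x , v≡ = singleton⁻ v s m in suc x , cong (false ∷_) v≡

not-false : ∀ {b} → not b ≡ false → b ≡ true
not-false {true} _ = refl

notSingleton-false : ∀ {n} (v : Subset n) →
  notSingleton (some false v) (many false false v) ≡ false ⇔ (∃[ x ] v ≡ ⁅ x ⁆)
notSingleton-false v = mk⇔
  (λ h → let s , m = ∨-false (not (some false v)) h in singleton⁻ v (not-false s) m)
  (λ { (x , refl) → cong₂ (λ s m → not s ∨ m) (some⁺ false (x , x∈⁅x⁆ x)) (many-⁅⁆ x) })

empty-false : ∀ {n} (v : Subset n) →
  empty (some false v) (many false false v) ≡ false ⇔ Nonempty v
empty-false v = mk⇔ (λ h → some⁻ v (not-false h)) (λ u → cong not (some⁺ false u))

module _ (bad : Defect) {n : ℕ} {P : Subset n → Set}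
         (P⇔ : ∀ v → bad (some false v) (many false false v) ≡ false ⇔ P v) where

  rowDefect-false : ∀ v r → rowDefect bad v r ≡ false ⇔ (r ≡ false × P v)
  rowDefect-false v r = mk⇔
    (λ h → let r≡f , b≡f = ∨-false r h in r≡f , Equivalence.to (P⇔ v) b≡f)
    (λ { (refl , p) → Equivalence.from (P⇔ v) p })

  rowsDefect-false⁻ : ∀ {m} (M : Vec (Subset n) m) r → rowsDefect bad M r ≡ false →
                      r ≡ false × (∀ i → P (lookup M i))
  rowsDefect-false⁻ []      r h = h , λ ()
  rowsDefect-false⁻ (v ∷ M) r h =
    let d≡f , ps = rowsDefect-false⁻ M (rowDefect bad v r) h
        r≡f , p  = Equivalence.to (rowDefect-false v r) d≡f
    in r≡f , λ { zero → p ; (suc i) → ps i }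

  rowsDefect-false⁺ : ∀ {m} (M : Vec (Subset n) m) r → r ≡ false → (∀ i → P (lookup M i)) →
                      rowsDefect bad M r ≡ false
  rowsDefect-false⁺ []      r r≡f ps = r≡f
  rowsDefect-false⁺ (v ∷ M) r r≡f ps =
    rowsDefect-false⁺ M _ (Equivalence.from (rowDefect-false v r) (r≡f , ps zero)) (ps ∘ suc)

module _ {n : ℕ} (o : Subset n) (M : Vec (Subset n) n) (s : Subset n) where

  clashes-false⁻ : ∀ {k} p (G : Vec (Subset n) k) r → clashes o M s p G r ≡ false →
                   ∀ j → compatible o M s p (lookup G j) ≡ true
  clashes-false⁻ p (g ∷ G) r h zero    =
    not-false (proj₂ (∨-false r (clashes-initial o M s p G _ h)))
  clashes-false⁻ p (g ∷ G) r h (suc j) = clashes-false⁻ p G _ h j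

  clashes-false⁺ : ∀ {k} p (G : Vec (Subset n) k) r → r ≡ false →
                   (∀ j → compatible o M s p (lookup G j) ≡ true) → clashes o M s p G r ≡ false
  clashes-false⁺ p []      r r≡f c = r≡f
  clashes-false⁺ p (g ∷ G) r r≡f c =
    clashes-false⁺ p G _ (cong₂ (λ r b → r ∨ not b) r≡f (c zero)) (c ∘ suc)

  conflicts-false⁻ : ∀ {i k} (F : Vec (Subset n) i) (G : Vec (Subset n) k) r →
                     conflicts o M s F G r ≡ false →
                     ∀ i j → compatible o M s (lookup F i) (lookup G j) ≡ true
  conflicts-false⁻ (f ∷ F) G r h zero    = clashes-false⁻ f G r (conflicts-initial o M s F G _ h)
  conflicts-false⁻ (f ∷ F) G r h (suc i) = conflicts-false⁻ F G _ h i

  conflicts-false⁺ : ∀ {i k} (F : Vec (Subset n) i) (G : Vec (Subset n) k) r → r ≡ false →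
                     (∀ i j → compatible o M s (lookup F i) (lookup G j) ≡ true) →
                     conflicts o M s F G r ≡ false
  conflicts-false⁺ []      G r r≡f c = r≡f
  conflicts-false⁺ (f ∷ F) G r r≡f c =
    conflicts-false⁺ F G _ (clashes-false⁺ f G r r≡f (c zero)) (c ∘ suc)

module _ {n : ℕ} (o : Subset n) (M : Vec (Subset n) n) where
  open Attractors o M using (Attr)

  forces-⁅⁆ : ∀ q p → forces o M ⁅ q ⁆ ⁅ p ⁆ ≡ true ⇔ q ∈ Attr p
  forces-⁅⁆ q p = mk⇔ to (hits⁺ false (x∈⁅x⁆ q))
    where
    to : forces o M ⁅ q ⁆ ⁅ p ⁆ ≡ true → q ∈ Attr p
    to h with hits⁻ false ⁅ q ⁆ (Attr p) h
    ... | inj₂ (u , u∈⁅q⁆ , u∈) = subst (_∈ Attr p) (x∈⁅y⁆⇒x≡y q u∈⁅q⁆) u∈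

module _ (I : Instance) where
  open Instance I
  open Arena 𝒜
  open Strategies 𝒜 hiding (module Eve)
  open Attractors V∘ successors using (Attr)

  compatible⁻ : ∀ s p q → compatible V∘ successors ⁅ s ⁆ ⁅ p ⁆ ⁅ q ⁆ ≡ true →
                s ∈ Attr p × Comparable p q
  compatible⁻ s p q h
    with forces V∘ successors ⁅ s ⁆ ⁅ p ⁆ in s∈ | forces V∘ successors ⁅ q ⁆ ⁅ p ⁆ in q∈
  ... | true | true  = Equivalence.to (forces-⁅⁆ V∘ successors s p) s∈ ,
                       inj₂ (Equivalence.to (forces-⁅⁆ V∘ successors q p) q∈)
  ... | true | false = Equivalence.to (forces-⁅⁆ V∘ successors s p) s∈ ,
                       inj₁ (Equivalence.to (forces-⁅⁆ V∘ successors p q) h)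

  compatible⁺ : ∀ s p q → s ∈ Attr p → Comparable p q →
                compatible V∘ successors ⁅ s ⁆ ⁅ p ⁆ ⁅ q ⁆ ≡ true
  compatible⁺ s p q s∈ c rewrite Equivalence.from (forces-⁅⁆ V∘ successors s p) s∈ with c
  ... | inj₂ q∈ rewrite Equivalence.from (forces-⁅⁆ V∘ successors q p) q∈ = refl
  ... | inj₁ p∈ rewrite Equivalence.from (forces-⁅⁆ V∘ successors p q) p∈ =
    ∨-zeroʳ (forces V∘ successors ⁅ q ⁆ ⁅ p ⁆)

  verdict-sound : verdict V∘ successors F ⁅ v₀ ⁆ ≡ false → AllSingletons × EveWins game v₀
  verdict-sound h = singletons , Strategies.Eve.σ 𝒜 ts total , wins
    where
    initial = conflicts-initial V∘ successors ⁅ v₀ ⁆ F F _ h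
    singletons : AllSingletons
    singletons = proj₂ (rowsDefect-false⁻ notSingleton notSingleton-false F _
      (proj₁ (Equivalence.to (rowDefect-false notSingleton notSingleton-false ⁅ v₀ ⁆ _) initial)))
    target : Fin k → V
    target i = proj₁ (singletons i)
    pairs : ∀ i j → v₀ ∈ Attr (target i) × Comparable (target i) (target j)
    pairs i j = compatible⁻ v₀ (target i) (target j)
      (trans (cong₂ (compatible V∘ successors ⁅ v₀ ⁆)
               (sym (proj₂ (singletons i))) (sym (proj₂ (singletons j))))
             (conflicts-false⁻ V∘ successors ⁅ v₀ ⁆ F F _ h i j))
    ts : List V
    ts = List.tabulate target
    total : ∀ {x y} → x ∈ₗ ts → y ∈ₗ ts → Comparable x y
    total x∈ y∈ with ∈-tabulate⁻ x∈ | ∈-tabulate⁻ y∈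
    ... | i , refl | j , refl = proj₂ (pairs i j)
    -- The diagonal pairs carry the condition on the start; with no targets there is no pair and
    -- nothing to reach.
    reach : ∀ {t} → t ∈ₗ ts → v₀ ∈ Attr t
    reach t∈ with ∈-tabulate⁻ t∈
    ... | i , refl = proj₁ (pairs i i)
    wins : (τ : AdamStrategy 𝒜) → GenReach F (π v₀ (Strategies.Eve.σ 𝒜 ts total) τ)
    wins τ i =
      let p , c≡t = Strategies.Eve.reaches-all 𝒜 ts total v₀ reach τ (∈-tabulate⁺ i)
      in p , subst₂ _∈_ (sym c≡t) (sym (proj₂ (singletons i))) (x∈⁅x⁆ (target i))

  verdict-complete : AllSingletons → EveWins game v₀ → verdict V∘ successors F ⁅ v₀ ⁆ ≡ false
  verdict-complete singletons (σ , wins) =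
    conflicts-false⁺ V∘ successors ⁅ v₀ ⁆ F F _
      (Equivalence.from (rowDefect-false notSingleton notSingleton-false ⁅ v₀ ⁆ _)
        (rowsDefect-false⁺ notSingleton notSingleton-false F _
          (rowsDefect-false⁺ empty empty-false successors _ refl no-dead-end) singletons , v₀ , refl))
      compatible-pairs
    where
    target : Fin k → V
    target i = proj₁ (singletons i)
    visits : ∀ i (τ : AdamStrategy 𝒜) → ∃[ p ] current v₀ σ τ p ≡ target i
    visits i τ =
      let p , c∈ = wins τ i
      in p , x∈⁅y⁆⇒x≡y (target i) (subst (_ ∈_) (proj₂ (singletons i)) c∈)
    compatible-pairs : ∀ i j → compatible V∘ successors ⁅ v₀ ⁆ (lookup F i) (lookup F j) ≡ true
    compatible-pairs i j rewrite proj₂ (singletons i) | proj₂ (singletons j) =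
      compatible⁺ v₀ (target i) (target j) (necessary-start v₀ σ (target i) (visits i))
        (necessary-comparable v₀ σ (target i) (target j) (visits i) (visits j))

Winning : Instance → Set
Winning I = Instance.AllSingletons I × EveWins (Instance.game I) (Instance.v₀ I)

rejectsWord-correct : ∀ w → rejectsWord w ≡ false ⇔ language Winning w
rejectsWord-correct w = mk⇔ to from
  where
  from : language Winning w → rejectsWord w ≡ false
  from (I , refl , singletons , wins) =
    trans (rejectsWord-word (Arena.V∘ 𝒜) (Arena.successors 𝒜) F ⁅ v₀ ⁆)
          (verdict-complete I singletons wins)
    where open Instance I

  to : rejectsWord w ≡ false → language Winning w
  to h with rejectsWord-sound w h
  ... | n , k , o , M , F , s , refl
    with h′ ← trans (sym (rejectsWord-word o M F s)) h
    -- The check of `s` produces the starting vertex, and the remaining flag `d` contains the check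
    -- of the matrix rows that becomes `no-dead-end`.
    with d , v₀ , refl ← Equivalence.to (rowDefect-false notSingleton notSingleton-false s
                             (defects o M F))
                           (conflicts-initial o M s F F
                             (rowDefect notSingleton s (defects o M F)) h′) =
    I , refl , verdict-sound I h′
    where
    I : Instance
    I = record
      { 𝒜  = record
        { ∣V∣         = n
        ; V∘          = o
        ; successors  = M
        ; no-dead-end = proj₂ (rowsDefect-false⁻ empty empty-false M false
                          (proj₁ (rowsDefect-false⁻ notSingleton notSingleton-false F (rowsDefect empty M false) d)))
        }
      ; k  = k
      ; F  = F
      ; v₀ = v₀
      }

theorem4 : PTIME (language (λ I → Instance.AllSingletons I × EveWins (Instance.game I) (Instance.v₀ I)))
theorem4 =
  let M , c , d , decides = decided-in-polynomial-time
  in M , c , d , λ w → not (rejectsWord w) , decides w ,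
     mk⇔ (λ accepted → Equivalence.to (rejectsWord-correct w) (not-true accepted))
         (λ w∈L → cong not (Equivalence.from (rejectsWord-correct w) w∈L))
  where
  not-true : ∀ {b} → not b ≡ true → b ≡ false
  not-true {false} _ = refl
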